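{- The set of degree sequences $$\mathbb D:=\bigcup\{\mathbb D(n,\Sigma,c_1,c_2)\;:\;\mathbb D(n,\Sigma,c_1,c_2)\text{ is fully graphic}\},$$ where the union ranges over all positive integers $n>c_1\ge c_2$ and all even positive integers $\Sigma$, is $P$-stable.
   Context: A degree sequence of length $n$ is a sequence $D=(d_1,\dots,d_n)$ of positive integers, each at most $n-1$, with even sum; write $|D|=n$. It is graphic if there is a simple graph on vertex set $\{1,\dots,n\}$ in which vertex $i$ has degree $d_i$ for every $i$; such a graph is called a realization of $D$. $\mathcal G(D)$ denotes the set of all (labelled) realizations of $D$; it is empty if $D$ (an arbitrary integer vector) has no realization. For positive integers $n>c_1\ge c_2$ and even $\Sigma$, $\mathbb D(n,\Sigma,c_1,c_2)$ is the set of all degree sequences $(d_1,\dots,d_n)$ of length $n$ with $c_1\ge d_i\ge c_2$ for all $i$ and $\sum_i d_i=\Sigma$. A set of degree sequences is fully graphic if every element of it is graphic. For $1\le i,j\le n$, $1^{+i}_{+j}$ denotes the integer vector $e_i+e_j$ of length $n$, where $e_i$ is the $i$th standard unit vector. For a graphic degree sequence $D$ of length $n$, $$\partial^{++}(D)=\sum_{1\le i<j\le n}\frac{|\mathcal G(D+1^{+i}_{+j})|}{|\mathcal G(D)|}.$$ An infinite set $\mathbb D$ of degree sequences is called $P$-stable if there is a polynomial $p$ such that $\partial^{++}(D)\le p(|D|)$ for every graphic $D\in\mathbb D$. -}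

module Defs where

open import Data.Bool.Base using (true; false)
open import Data.Fin.Base using (Fin)
import Data.Fin.Base as Fin
import Data.Fin.Properties as Fin
open import Data.Fin.Subset using (Subset; _∈_; _∉_; ∣_∣)
open import Data.Fin.Subset.Properties using (_∈?_)
open import Data.Integer.Base using (+_)
open import Data.List.Base using (List; []; _∷_; [_]; allFin; cartesianProduct;
  cartesianProductWith; filter; foldr; length; map)
import Data.List.Membership.Propositional as List
open import Data.List.Membership.Propositional.Properties
  using (∈-cartesianProductWith⁺; ∈-filter⁺; ∈-filter⁻; ∈-length)
open import Data.List.Relation.Unary.All using ([]; _∷_)
open import Data.List.Relation.Unary.AllPairs using ([]; _∷_)
open import Data.List.Relation.Unary.Any using (here; there)
open import Data.List.Relation.Unary.Unique.Propositional using (Unique)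
import Data.List.Relation.Unary.Unique.Propositional.Properties as Unique
open import Data.Nat.Base using (ℕ; zero; suc; _+_; _∸_; _≤_; NonZero; >-nonZero)
open import Data.Nat.Divisibility using (_∣_)
import Data.Nat.Properties as ℕ
open import Data.Product using (Σ-syntax; ∃; ∃-syntax; _×_; _,_; proj₂)
open import Data.Rational.Base as ℚ using (ℚ; 0ℚ; _/_)
open import Data.Vec.Base using (Vec; []; _∷_; lookup; replicate; sum; zipWith; _[_]≔_)
open import Data.Vec.Properties using (∷-injective)
open import Function.Definitions using (Injective)
open import Relation.Binary.PropositionalEquality using (_≡_; refl)
open import Relation.Nullary.Decidable using (Dec; ¬?; _×-dec_; _→-dec_)
open import Relation.Unary using (Pred)
import Relation.Unary as Set
open import Level using (0ℓ)

private
  variable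
    n : ℕ

-- Entry i is the set of neighbours of vertex i, i.e. row i of the
-- adjacency matrix. Being first-order data, two labelled graphs are equal
-- (≡) exactly when they have the same edges.
Adjacency : ℕ → Set
Adjacency n = Vec (Subset n) n

neighbours : Adjacency n → Fin n → Subset n
neighbours = lookup

degree : Adjacency n → Fin n → ℕ
degree G i = ∣ neighbours G i ∣

IsSimpleGraph : Pred (Adjacency n) 0ℓ
IsSimpleGraph G =
  (∀ i → i ∉ neighbours G i) ×
  (∀ i j → j ∈ neighbours G i → i ∈ neighbours G j)

Realizes : Vec ℕ n → Pred (Adjacency n) 0ℓ
Realizes D G = IsSimpleGraph G × (∀ i → degree G i ≡ lookup D i)

realizes? : (D : Vec ℕ n) → Set.Decidable (Realizes D)
realizes? D G =
  (Fin.all? (λ i → ¬? (i ∈? neighbours G i)) ×-dec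
   Fin.all? (λ i → Fin.all? (λ j →
     (j ∈? neighbours G i) →-dec (i ∈? neighbours G j)))) ×-dec
  Fin.all? (λ i → degree G i ℕ.≟ lookup D i)

allVecs : {A : Set} → List A → (n : ℕ) → List (Vec A n)
allVecs xs zero    = [ [] ]
allVecs xs (suc n) = cartesianProductWith _∷_ xs (allVecs xs n)

allSubsets : (n : ℕ) → List (Subset n)
allSubsets = allVecs (true ∷ false ∷ [])

-- The finite set 𝒢(D), as a list; ∈-𝒢⁺, ∈-𝒢⁻ and 𝒢-unique below show that it
-- contains each realization of D exactly once, and nothing else.
𝒢 : Vec ℕ n → List (Adjacency n)
𝒢 {n} D = filter (realizes? D) (allVecs (allSubsets n) n)

∣𝒢∣ : Vec ℕ n → ℕ
∣𝒢∣ D = length (𝒢 D)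

∈-allVecs : {A : Set} {xs : List A} → (∀ x → x List.∈ xs) →
            ∀ {n} (v : Vec A n) → v List.∈ allVecs xs n
∈-allVecs all∈ []      = here refl
∈-allVecs all∈ (x ∷ v) = ∈-cartesianProductWith⁺ _∷_ (all∈ x) (∈-allVecs all∈ v)

allVecs-unique : {A : Set} {xs : List A} → Unique xs → ∀ n → Unique (allVecs xs n)
allVecs-unique xs! zero    = [] ∷ []
allVecs-unique xs! (suc n) =
  Unique.cartesianProductWith⁺ _∷_ ∷-injective xs! (allVecs-unique xs! n)

∈-allSubsets : (S : Subset n) → S List.∈ allSubsets n
∈-allSubsets = ∈-allVecs λ { true → here refl ; false → there (here refl) }

∈-𝒢⁺ : (D : Vec ℕ n) {G : Adjacency n} → Realizes D G → G List.∈ 𝒢 D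
∈-𝒢⁺ D {G} r = ∈-filter⁺ (realizes? D) (∈-allVecs ∈-allSubsets G) r

∈-𝒢⁻ : (D : Vec ℕ n) {G : Adjacency n} → G List.∈ 𝒢 D → Realizes D G
∈-𝒢⁻ {n} D G∈ = proj₂ (∈-filter⁻ (realizes? D) {xs = allVecs (allSubsets n) n} G∈)

𝒢-unique : (D : Vec ℕ n) → Unique (𝒢 D)
𝒢-unique {n} D = Unique.filter⁺ (realizes? D)
  (allVecs-unique (allVecs-unique (((λ ()) ∷ []) ∷ [] ∷ []) n) n)

Seq : Set
Seq = ∃[ n ] Vec ℕ n

IsDegreeSequence : Pred Seq 0ℓ
IsDegreeSequence (n , D) =
  (∀ i → 1 ≤ lookup D i × lookup D i ≤ n ∸ 1) × 2 ∣ sum D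

Graphic : Pred Seq 0ℓ
Graphic (n , D) = ∃[ G ] Realizes D G

𝔻 : (n s c₁ c₂ : ℕ) → Pred Seq 0ℓ
𝔻 n s c₁ c₂ (m , D) =
  IsDegreeSequence (m , D) ×
  m ≡ n ×
  (∀ i → lookup D i ≤ c₁ × c₂ ≤ lookup D i) ×
  sum D ≡ s

FullyGraphic : Pred Seq 0ℓ → Set
FullyGraphic 𝔼 = 𝔼 Set.⊆ Graphic

unit : Fin n → Vec ℕ n
unit {n} i = replicate n 0 [ i ]≔ 1

infixl 6 _⊕_

_⊕_ : Vec ℕ n → Vec ℕ n → Vec ℕ n
_⊕_ = zipWith _+_

graphic⇒nonZero : ((n , D) : Seq) → Graphic (n , D) → NonZero (∣𝒢∣ D)
graphic⇒nonZero (n , D) (G , r) = >-nonZero (∈-length (∈-𝒢⁺ D {G} r))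

pairs : (n : ℕ) → List (Fin n × Fin n)
pairs n = filter (λ (i , j) → i Fin.<? j) (cartesianProduct (allFin n) (allFin n))

sumℚ : List ℚ → ℚ
sumℚ = foldr ℚ._+_ 0ℚ

ratio : (D : Seq) → Graphic D → let (n , _) = D in Fin n × Fin n → ℚ
ratio (n , D) g (i , j) =
  _/_ (+ ∣𝒢∣ (D ⊕ (unit i ⊕ unit j))) (∣𝒢∣ D) {{graphic⇒nonZero (n , D) g}}

∂⁺⁺ : (D : Seq) → Graphic D → ℚ
∂⁺⁺ (n , D) g = sumℚ (map (ratio (n , D) g) (pairs n))

-- A polynomial in one variable, as its coefficients from the constant term
-- upwards. Rational coefficients are as general as real ones here, since
-- polynomials only serve as upper bounds at natural numbers.
Polynomial : Set
Polynomial = List ℚ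

eval : Polynomial → ℚ → ℚ
eval p x = foldr (λ a r → a ℚ.+ x ℚ.* r) 0ℚ p

Infinite : {A : Set} → Pred A 0ℓ → Set
Infinite {A} P = Σ[ f ∈ (ℕ → A) ] Injective _≡_ _≡_ f × (∀ k → f k Set.∈ P)

record PStable (𝔼 : Pred Seq 0ℓ) : Set where
  field
    degreeSequences : 𝔼 Set.⊆ IsDegreeSequence
    infinite        : Infinite 𝔼
    bounded         : ∃[ p ] ∀ {n} {D : Vec ℕ n} → (n , D) Set.∈ 𝔼 →
                      (g : Graphic (n , D)) →
                      ∂⁺⁺ (n , D) g ℚ.≤ eval p (+ n / 1)

{-# OPTIONS --safe #-}

-- Let A realize D + e_u + e_v, where D lies in a fully graphic region. It is enough
-- to find a realization of D that agrees with A outside a vertex set S of bounded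
-- size: A is then recovered from it by polynomially many possible edits.
--
-- Read A as a 0/1 matrix and search for alternating walks from a row to a column
-- whose sum is too large. If no short walk exists, the sets reached are almost
-- tight for the Erdős–Gallai inequality, and transferring degree between the
-- last two levels yields a sequence with the same sum and the same bounds that is not
-- graphic, a contradiction. Two walks thus correct all row and column sums, at
-- the price of making the matrix asymmetric on few entries.
--
-- The asymmetric pairs form a balanced digraph, which decomposes into closed trails.
-- Along a trail of even length every second pair is made an edge and the others
-- non-edges. Trails of odd length come in pairs, which are joined at a common
-- vertex, or through a pair that is already symmetric and gets toggled.
module Submission where

open import Defs
open import Data.Bool.Base using (Bool; true; false; not; _∧_; _∨_; _xor_; if_then_else_)
open import Data.Bool.Properties using () renaming (_≟_ to _≟ᵇ_)
open import Data.Empty using (⊥; ⊥-elim)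
open import Data.Fin.Base using (Fin; zero; suc)
open import Data.Fin.Properties using (_≟_; any?)
open import Data.Fin.Subset using (Subset; ∣_∣)
import Data.Integer.Base as ℤ
import Data.Integer.Properties as ℤ
open import Data.List.Base using (List; []; _∷_; _++_; length; map; filter; replicate; tabulate; allFin; cartesianProduct; cartesianProductWith)
import Data.List.Membership.DecPropositional as DecMembership
open import Data.List.Membership.Propositional using () renaming (_∈_ to _∈ₗ_)
open import Data.List.Membership.Propositional.Properties
  using (∈-++⁺ˡ; ∈-++⁺ʳ; ∈-∃++; ∈-map⁺; ∈-filter⁻; ∈-cartesianProductWith⁺; ∈-cartesianProduct⁺; ∈-allFin)
open import Data.List.Properties using (++-assoc; length-++; length-map; length-filter; length-tabulate)
open import Data.List.Relation.Binary.Permutation.Propositional as Perm using (_↭_; ↭-refl; ↭-trans; ↭-prep; ↭-reflexive)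
open import Data.List.Relation.Binary.Permutation.Propositional.Properties
  using (All-resp-↭; ∈-resp-↭; ↭-length; shift; shifts; ++⁺; ++⁺ˡ; ++⁺ʳ; ++-comm)
open import Data.List.Relation.Unary.All as All using (All; []; _∷_)
open import Data.List.Relation.Unary.All.Properties using (++⁻ʳ; ++⁻ˡ) renaming (++⁺ to All-++⁺)
open import Data.List.Relation.Unary.AllPairs using (AllPairs; []; _∷_)
open import Data.List.Relation.Unary.Any using (here; there)
open import Data.List.Relation.Unary.Unique.Propositional using (Unique)
import Data.List.Relation.Unary.Unique.Propositional.Properties as Unique
open import Data.Nat.Base
open import Data.Nat.Divisibility using (_∣_; ∣m∣n⇒∣m+n; ∣m+n∣m⇒∣n; m∣m*n; _∣0; ∣1⇒≡1)
open import Data.Nat.Properties hiding (_≟_)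
open import Data.Nat.Tactic.RingSolver using (solve-∀)
open import Data.Product using (∃; ∃-syntax; ∃₂; _×_; _,_; proj₁; proj₂)
open import Data.Product.Properties using (≡-dec)
open import Data.Rational.Base as ℚ using (ℚ; 0ℚ)
import Data.Rational.Properties as ℚ
import Data.Rational.Unnormalised.Base as ℚᵘ
import Data.Rational.Unnormalised.Properties as ℚᵘ
open import Data.Sum.Base using (_⊎_; inj₁; inj₂)
open import Data.Vec.Base as Vec using (Vec; []; _∷_; lookup)
import Data.Vec.Membership.Propositional as Vec
import Data.Vec.Membership.Propositional.Properties as Vec
import Data.Vec.Properties as Vec
import Data.Vec.Relation.Unary.Any as VecAny
open import Function.Base using (_∘_; flip; case_of_)
open import Level using (0ℓ)
open import Relation.Binary.PropositionalEquality
open import Relation.Nullary.Decidable using (Dec; yes; no; does; dec-true; dec-false; ¬?; _×-dec_)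
open import Relation.Nullary.Negation using (¬_)
open import Relation.Unary using (Pred; Decidable; _∈_)
open import Algebra.Properties.Semiring.Sum +-*-semiring
  using (∑-distrib-+; ∑-comm; *-distribˡ-sum; *-distribʳ-sum) renaming (sum to ∑; sum-cong-≗ to ∑-cong)

-- Rows and columns are searched as the two sides of a bipartite graph. An alternating walk in the
-- graph itself could use a pair in both directions and would meet parity obstructions. Keeping the
-- sides apart costs only symmetry, and parity enters just once, in the rounding: an odd trail left
-- without a partner contradicts the even sum of `D`.
--
-- A barrier needs three consecutive levels, since the inner ones provide two estimates. A row with
-- excess has all its ones in the innermost column set, which therefore has at least `c₂` elements.
-- A column of that set has ones in all rows outside the next row set, except possibly on the
-- diagonal, so at most `c₁ + 1` rows are missing from that set. This is why degrees pushed to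
-- exactly `c₂` or `c₁` between the last two levels break the inequality.
--
-- No constant depends on `n`: the length of a walk is bounded in terms of the support of the
-- changes made before it, and there are only two walks.

private
  variable
    n : ℕ

-- Sums over Fin n and 0/1 matrices

⟦_⟧ : Bool → ℕ
⟦ true ⟧  = 1
⟦ false ⟧ = 0

⟦⟧≤1 : ∀ b → ⟦ b ⟧ ≤ 1
⟦⟧≤1 true  = ≤-refl
⟦⟧≤1 false = z≤n

clash : ∀ {b : Bool} → b ≡ true → b ≡ false → ⊥
clash p q = case trans (sym p) q of λ ()

from-does : ∀ {A : Set} (d : Dec A) → does d ≡ true → A
from-does (yes a) _ = a

not-true : ∀ {b} → not b ≡ true → b ≡ false
not-true {false} _ = refl

not-false : ∀ {b} → not b ≡ false → b ≡ true
not-false {true} _ = refl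

dichotomy : ∀ b → b ≡ true ⊎ b ≡ false
dichotomy true  = inj₁ refl
dichotomy false = inj₂ refl

≢true : ∀ {b} → ¬ b ≡ true → b ≡ false
≢true {true}  ne = ⊥-elim (ne refl)
≢true {false} ne = refl

∑-mono : {f g : Fin n → ℕ} → (∀ i → f i ≤ g i) → ∑ f ≤ ∑ g
∑-mono {zero}  f≤g = z≤n
∑-mono {suc n} f≤g = +-mono-≤ (f≤g zero) (∑-mono (f≤g ∘ suc))

∑-mono-< : {f g : Fin n → ℕ} → (∀ i → f i ≤ g i) → ∀ j → f j < g j → ∑ f < ∑ g
∑-mono-< f≤g zero    f<g = +-mono-<-≤ f<g (∑-mono (f≤g ∘ suc))
∑-mono-< f≤g (suc j) f<g = +-mono-≤-< (f≤g zero) (∑-mono-< (f≤g ∘ suc) j f<g)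

∑-const : ∀ n c → ∑ {n} (λ _ → c) ≡ n * c
∑-const zero    c = refl
∑-const (suc n) c = cong (c +_) (∑-const n c)

∑-zero : {f : Fin n → ℕ} → (∀ i → f i ≡ 0) → ∑ f ≡ 0
∑-zero {n} f≡0 = trans (∑-cong f≡0) (trans (∑-const n 0) (*-zeroʳ n))

f≤∑ : (f : Fin n → ℕ) → ∀ i → f i ≤ ∑ f
f≤∑ f zero    = m≤m+n _ _
f≤∑ f (suc i) = ≤-trans (f≤∑ (f ∘ suc) i) (m≤n+m _ (f zero))

∑-positive : (f : Fin n → ℕ) → 1 ≤ ∑ f → ∃[ i ] 1 ≤ f i
∑-positive {suc n} f 1≤∑ with f zero in eq
... | suc m = zero , subst (1 ≤_) (sym eq) (s≤s z≤n)
... | zero  with i , p ← ∑-positive (f ∘ suc) 1≤∑ = suc i , p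

δ : Fin n → Fin n → ℕ
δ i j = ⟦ does (i ≟ j) ⟧

δ-same : (i : Fin n) → δ i i ≡ 1
δ-same i = cong ⟦_⟧ (dec-true (i ≟ i) refl)

δ-diff : {i j : Fin n} → i ≢ j → δ i j ≡ 0
δ-diff {i = i} {j} i≢j = cong ⟦_⟧ (dec-false (i ≟ j) i≢j)

δ-cases : (i j : Fin n) → (i ≡ j × δ i j ≡ 1) ⊎ (i ≢ j × δ i j ≡ 0)
δ-cases i j with i ≟ j
... | yes eq = inj₁ (eq , refl)
... | no  ne = inj₂ (ne , refl)

δ-sym : (i j : Fin n) → δ i j ≡ δ j i
δ-sym i j with δ-cases i j
... | inj₁ (refl , _) = refl
... | inj₂ (ne , p)   = trans p (sym (δ-diff (ne ∘ sym)))

∑-δ : (i : Fin n) → ∑ (δ i) ≡ 1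
∑-δ {suc n} zero = cong suc (trans (∑-const n 0) (*-zeroʳ n))
∑-δ {suc n} (suc i) = trans (∑-cong lift) (∑-δ i)
  where
  lift : ∀ j → δ (suc i) (suc j) ≡ δ i j
  lift j with δ-cases i j
  ... | inj₁ (refl , p) = trans (δ-same (suc i)) (sym p)
  ... | inj₂ (ne , p)   = trans (δ-diff {i = suc i} {suc j} λ { refl → ne refl }) (sym p)

Mat : ℕ → Set
Mat n = Fin n → Fin n → Bool

row : Mat n → Fin n → ℕ
row B i = ∑ λ k → ⟦ B i k ⟧

col : Mat n → Fin n → ℕ
col B = row (flip B)

Symmetric Loopless : Mat n → Set
Symmetric B = ∀ i k → B i k ≡ B k i
Loopless B = ∀ i → B i i ≡ false

-- Changes are confined to the square on `S`, so the square of `length S` bounds the number of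
-- entries to restore. Lists with repetitions make unions plain concatenations.
Close : List (Fin n) → Mat n → Mat n → Set
Close S A B = ∀ i k → (i ∈ₗ S × k ∈ₗ S) ⊎ A i k ≡ B i k

Close-refl : {A : Mat n} → Close [] A A
Close-refl i k = inj₂ refl

Close-weaken : ∀ {S T} {A B : Mat n} → (∀ {x} → x ∈ₗ S → x ∈ₗ T) → Close S A B → Close T A B
Close-weaken S⊆T c i k with c i k
... | inj₁ (p , q) = inj₁ (S⊆T p , S⊆T q)
... | inj₂ eq      = inj₂ eq

Close-trans′ : ∀ {S} {A B C : Mat n} → Close S A B → Close S B C → Close S A C
Close-trans′ c d i k with c i k | d i k
... | inj₁ p | _       = inj₁ p
... | inj₂ _ | inj₁ q  = inj₁ q
... | inj₂ p | inj₂ q  = inj₂ (trans p q)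

Close-trans : ∀ S T {A B C : Mat n} → Close S A B → Close T B C → Close (S ++ T) A C
Close-trans S T c d = Close-trans′ (Close-weaken ∈-++⁺ˡ c) (Close-weaken (∈-++⁺ʳ S) d)

set : Fin n → Fin n → Bool → Mat n → Mat n
set i k v B a c = if does (a ≟ i) ∧ does (c ≟ k) then v else B a c

set-same : ∀ (i k : Fin n) v B → set i k v B i k ≡ v
set-same i k v B rewrite dec-true (i ≟ i) refl | dec-true (k ≟ k) refl = refl

set-diff : ∀ (i k : Fin n) v B a c → ¬ (a ≡ i × c ≡ k) → set i k v B a c ≡ B a c
set-diff i k v B a c ne with a ≟ i | c ≟ k
... | yes p | yes q = ⊥-elim (ne (p , q))
... | yes p | no  q = refl
... | no  p | yes q = refl
... | no  p | no  q = refl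

-- Relating two matrices instead of speaking of `set` lets one lemma serve both for clearing an
-- entry and, with the roles exchanged, for filling one.
row-drop : ∀ (B C : Mat n) i k → (∀ a c → ¬ (a ≡ i × c ≡ k) → B a c ≡ C a c) →
           B i k ≡ true → C i k ≡ false → ∀ a → row C a + δ i a ≡ row B a
row-drop B C i k same Bik Cik a with δ-cases i a
... | inj₂ (ne , p) rewrite p = trans (+-identityʳ _)
  (∑-cong λ c → cong ⟦_⟧ (sym (same a c λ (q , _) → ne (sym q))))
... | inj₁ (refl , p) rewrite p = begin
  row C a + 1                    ≡⟨ cong (row C a +_) (sym (∑-δ k)) ⟩
  row C a + ∑ (δ k)              ≡⟨ sym (∑-distrib-+ (λ c → ⟦ C a c ⟧) (δ k)) ⟩
  ∑ (λ c → ⟦ C a c ⟧ + δ k c)    ≡⟨ ∑-cong pointwise ⟩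
  row B a                        ∎
  where
  open ≡-Reasoning
  pointwise : ∀ c → ⟦ C a c ⟧ + δ k c ≡ ⟦ B a c ⟧
  pointwise c with δ-cases k c
  ... | inj₁ (refl , q) rewrite q | Bik | Cik = refl
  ... | inj₂ (ne , q) rewrite q = trans (+-identityʳ _) (cong ⟦_⟧ (sym (same a c λ (_ , r) → ne (sym r))))

col-drop : ∀ (B C : Mat n) i k → (∀ a c → ¬ (a ≡ i × c ≡ k) → B a c ≡ C a c) →
           B i k ≡ true → C i k ≡ false → ∀ c → col C c + δ k c ≡ col B c
col-drop B C i k same = row-drop (flip B) (flip C) k i λ a c ne → same c a λ (p , q) → ne (q , p)

-- Degree transfers and the Erdős–Gallai barrier

n∸1<n : ∀ {m} → 0 < m → m ∸ 1 < m
n∸1<n {suc m} _ = ≤-refl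

Disjoint : (X Y : Fin n → Bool) → Set
Disjoint X Y = ∀ i → X i ≡ true → Y i ≡ true → ⊥

record Within (c₁ c₂ : ℕ) (D : Fin n → ℕ) : Set where
  constructor within
  field
    lower : ∀ i → c₂ ≤ D i
    upper : ∀ i → D i ≤ c₁

-- `exhausted` is the stopping condition of moving single units from `X` to `Y`: a further move
-- needs a member of `X` above `c₂` and a member of `Y` below `c₁`.
record Shifted (c₁ c₂ : ℕ) (X Y : Fin n → Bool) (D D′ : Fin n → ℕ) : Set where
  field
    bounds    : Within c₁ c₂ D′
    total     : ∑ D′ ≡ ∑ D
    unchanged : ∀ i → X i ≡ false → Y i ≡ false → D′ i ≡ D i
    lowered   : ∀ i → X i ≡ true → D′ i ≤ D i
    raised    : ∀ i → Y i ≡ true → D i ≤ D′ i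
    exhausted : (∀ i → X i ≡ true → D′ i ≡ c₂) ⊎ (∀ i → Y i ≡ true → D′ i ≡ c₁)

module _ {c₁ c₂ : ℕ} {X Y : Fin n → Bool} (disjoint : Disjoint X Y) where

  private
    weight : (Fin n → ℕ) → ℕ
    weight D = ∑ λ i → ⟦ X i ⟧ * D i

    move : Fin n → Fin n → (Fin n → ℕ) → Fin n → ℕ
    move i k D a = (D a ∸ δ i a) + δ k a

    module _ (D : Fin n → ℕ) {i k : Fin n} (i∈X : X i ≡ true) (k∈Y : Y k ≡ true)
             (D∈ : Within c₁ c₂ D) (c₂<Di : c₂ < D i) (Dk<c₁ : D k < c₁) where
      open Within D∈

      i≢k : i ≢ k
      i≢k refl = disjoint i i∈X k∈Y

      move-source : move i k D i ≡ D i ∸ 1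
      move-source rewrite δ-same i | δ-diff (i≢k ∘ sym) = +-identityʳ _

      move-target : move i k D k ≡ suc (D k)
      move-target rewrite δ-same k | δ-diff i≢k = +-comm (D k) 1

      move-other : ∀ a → i ≢ a → k ≢ a → move i k D a ≡ D a
      move-other a p q rewrite δ-diff p | δ-diff q = +-identityʳ _

      data Place (a : Fin n) : Set where
        source : i ≡ a → Place a
        target : k ≡ a → Place a
        other  : i ≢ a → k ≢ a → Place a

      place : ∀ a → Place a
      place a with i ≟ a | k ≟ a
      ... | yes p | _     = source p
      ... | no _  | yes q = target q
      ... | no p  | no q  = other p q

      move-bounds : Within c₁ c₂ (move i k D)
      move-bounds = within lo hi
        where
        lo : ∀ a → c₂ ≤ move i k D a
        lo a with place a
        ... | source refl rewrite move-source = ∸-monoˡ-≤ 1 c₂<Di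
        ... | target refl rewrite move-target = m≤n⇒m≤1+n (lower k)
        ... | other p q   rewrite move-other a p q = lower a
        hi : ∀ a → move i k D a ≤ c₁
        hi a with place a
        ... | source refl rewrite move-source = ≤-trans (m∸n≤m _ 1) (upper i)
        ... | target refl rewrite move-target = Dk<c₁
        ... | other p q   rewrite move-other a p q = upper a

      move-total : ∑ (move i k D) ≡ ∑ D
      move-total = +-cancelʳ-≡ 1 _ _ (begin
        ∑ (move i k D) + 1                ≡⟨ cong (∑ (move i k D) +_) (sym (∑-δ i)) ⟩
        ∑ (move i k D) + ∑ (δ i)          ≡⟨ sym (∑-distrib-+ (move i k D) (δ i)) ⟩
        ∑ (λ a → move i k D a + δ i a)    ≡⟨ ∑-cong pointwise ⟩
        ∑ (λ a → D a + δ k a)             ≡⟨ ∑-distrib-+ D (δ k) ⟩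
        ∑ D + ∑ (δ k)                     ≡⟨ cong (∑ D +_) (∑-δ k) ⟩
        ∑ D + 1                           ∎)
        where
        open ≡-Reasoning
        pointwise : ∀ a → move i k D a + δ i a ≡ D a + δ k a
        pointwise a with δ-cases i a
        ... | inj₂ (_ , p) rewrite p = +-identityʳ _
        ... | inj₁ (refl , p) rewrite p | δ-diff (i≢k ∘ sym)
            | +-identityʳ (D i ∸ 1) | +-identityʳ (D i) = m∸n+n≡m (≤-trans (s≤s z≤n) c₂<Di)

      move-lowers : ∀ a → X a ≡ true → move i k D a ≤ D a
      move-lowers a a∈X with place a
      ... | source refl rewrite move-source = m∸n≤m _ 1
      ... | target refl = ⊥-elim (disjoint k a∈X k∈Y)
      ... | other p q   = ≤-reflexive (move-other a p q)

      move-raises : ∀ a → Y a ≡ true → D a ≤ move i k D a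
      move-raises a a∈Y with place a
      ... | source refl = ⊥-elim (disjoint i i∈X a∈Y)
      ... | target refl rewrite move-target = n≤1+n _
      ... | other p q   = ≤-reflexive (sym (move-other a p q))

      move-unchanged : ∀ a → X a ≡ false → Y a ≡ false → move i k D a ≡ D a
      move-unchanged a a∉X a∉Y = move-other a
        (λ { refl → case trans (sym i∈X) a∉X of λ () })
        (λ { refl → case trans (sym k∈Y) a∉Y of λ () })

      move-weight : weight (move i k D) < weight D
      move-weight = ∑-mono-< pointwise i strict
        where
        pointwise : ∀ a → ⟦ X a ⟧ * move i k D a ≤ ⟦ X a ⟧ * D a
        pointwise a with X a in a∈X
        ... | true  = +-monoˡ-≤ 0 (move-lowers a a∈X)
        ... | false = z≤n
        strict : ⟦ X i ⟧ * move i k D i < ⟦ X i ⟧ * D i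
        strict rewrite i∈X | move-source = +-monoˡ-< 0 (n∸1<n (≤-<-trans z≤n c₂<Di))

  -- Each move lowers the total degree on `X`, so `weight` bounds the number of moves.
  shiftDegrees-fuel : ∀ fuel D → weight D < fuel → Within c₁ c₂ D → ∃ (Shifted c₁ c₂ X Y D)
  shiftDegrees-fuel (suc fuel) D w<fuel D∈
    with any? (λ i → (X i ≟ᵇ true) ×-dec (c₂ <? D i)) | any? (λ k → (Y k ≟ᵇ true) ×-dec (D k <? c₁))
  ... | no none | _ = D , record
    { bounds = D∈ ; total = refl ; unchanged = λ _ _ _ → refl
    ; lowered = λ _ _ → ≤-refl ; raised = λ _ _ → ≤-refl
    ; exhausted = inj₁ λ i i∈X → ≤-antisym (≮⇒≥ λ lt → none (i , i∈X , lt)) (Within.lower D∈ i) }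
  ... | yes _ | no none = D , record
    { bounds = D∈ ; total = refl ; unchanged = λ _ _ _ → refl
    ; lowered = λ _ _ → ≤-refl ; raised = λ _ _ → ≤-refl
    ; exhausted = inj₂ λ i i∈Y → ≤-antisym (Within.upper D∈ i) (≮⇒≥ λ lt → none (i , i∈Y , lt)) }
  ... | yes (i , i∈X , c₂<Di) | yes (k , k∈Y , Dk<c₁)
    with D′ , s ← shiftDegrees-fuel fuel (move i k D)
           (<-≤-trans (move-weight D i∈X k∈Y D∈ c₂<Di Dk<c₁) (≤-pred w<fuel))
           (move-bounds D i∈X k∈Y D∈ c₂<Di Dk<c₁)
    = D′ , record
    { bounds = bounds
    ; total = trans total (move-total D i∈X k∈Y D∈ c₂<Di Dk<c₁)
    ; unchanged = λ a p q → trans (unchanged a p q) (move-unchanged D i∈X k∈Y D∈ c₂<Di Dk<c₁ a p q)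
    ; lowered = λ a p → ≤-trans (lowered a p) (move-lowers D i∈X k∈Y D∈ c₂<Di Dk<c₁ a p)
    ; raised = λ a p → ≤-trans (move-raises D i∈X k∈Y D∈ c₂<Di Dk<c₁ a p) (raised a p)
    ; exhausted = exhausted }
    where open Shifted s

  shiftDegrees : ∀ D → Within c₁ c₂ D → ∃ (Shifted c₁ c₂ X Y D)
  shiftDegrees D = shiftDegrees-fuel (suc (weight D)) D ≤-refl

∑∑-mono : {f g : Fin n → Fin n → ℕ} → (∀ i k → f i k ≤ g i k) →
          ∑ (λ i → ∑ (f i)) ≤ ∑ (λ i → ∑ (g i))
∑∑-mono f≤g = ∑-mono λ i → ∑-mono (f≤g i)

∑∑-distrib-+ : (f g : Fin n → Fin n → ℕ) →
               ∑ (λ i → ∑ (λ k → f i k + g i k)) ≡ ∑ (λ i → ∑ (f i)) + ∑ (λ i → ∑ (g i))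
∑∑-distrib-+ f g = trans (∑-cong λ i → ∑-distrib-+ (f i) (g i)) (∑-distrib-+ (λ i → ∑ (f i)) (λ i → ∑ (g i)))

∑-rows : (w : Fin n → ℕ) (f : Fin n → Fin n → ℕ) →
         ∑ (λ i → ∑ λ k → w i * f i k) ≡ ∑ (λ i → w i * ∑ (f i))
∑-rows w f = ∑-cong λ i → sym (*-distribˡ-sum (w i) (f i))

∑-cols : (w : Fin n → ℕ) (f : Fin n → Fin n → ℕ) →
         ∑ (λ i → ∑ λ k → w k * f i k) ≡ ∑ (λ k → w k * ∑ (λ i → f i k))
∑-cols w f = trans (∑-comm λ i k → w k * f i k) (∑-rows w (flip f))

-- The room for ones in the columns of `K` that avoid the rows of `I` and the diagonal. For disjoint
-- `K` and `I` it is the Erdős-Gallai term |K| (n - 1 - |I|).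
cells : (K I : Fin n → Bool) → ℕ
cells K I = ∑ λ i → ∑ λ k → ⟦ K k ∧ not (I i) ∧ not (does (i ≟ k)) ⟧

-- By symmetry the left side counts ones in the columns of `K`. Each of them lies in a row of `I`,
-- and is charged to that row, or else occupies one of the `cells`.
erdős-gallai : (H : Mat n) → Symmetric H → Loopless H → ∀ K I →
               ∑ (λ k → ⟦ K k ⟧ * row H k) ≤ cells K I + ∑ (λ i → ⟦ I i ⟧ * row H i)
erdős-gallai H symmetric loopless K I = begin
  ∑ (λ k → ⟦ K k ⟧ * row H k)                    ≡⟨ ∑-cong (λ k → cong (⟦ K k ⟧ *_) (∑-cong λ i → cong ⟦_⟧ (symmetric k i))) ⟩
  ∑ (λ k → ⟦ K k ⟧ * col H k)                    ≡⟨ sym (∑-cols (⟦_⟧ ∘ K) (λ i k → ⟦ H i k ⟧)) ⟩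
  ∑ (λ i → ∑ λ k → ⟦ K k ⟧ * ⟦ H i k ⟧)          ≤⟨ ∑∑-mono pointwise ⟩
  ∑ (λ i → ∑ λ k → ⟦ K k ∧ not (I i) ∧ not (does (i ≟ k)) ⟧ + ⟦ I i ⟧ * ⟦ H i k ⟧)
                                                 ≡⟨ ∑∑-distrib-+ (λ i k → ⟦ K k ∧ not (I i) ∧ not (does (i ≟ k)) ⟧) (λ i k → ⟦ I i ⟧ * ⟦ H i k ⟧) ⟩
  cells K I + ∑ (λ i → ∑ λ k → ⟦ I i ⟧ * ⟦ H i k ⟧)
                                                 ≡⟨ cong (cells K I +_) (∑-rows (⟦_⟧ ∘ I) (λ i k → ⟦ H i k ⟧)) ⟩
  cells K I + ∑ (λ i → ⟦ I i ⟧ * row H i)        ∎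
  where
  open ≤-Reasoning
  pointwise : ∀ i k → ⟦ K k ⟧ * ⟦ H i k ⟧ ≤ ⟦ K k ∧ not (I i) ∧ not (does (i ≟ k)) ⟧ + ⟦ I i ⟧ * ⟦ H i k ⟧
  pointwise i k with K k
  ... | false = z≤n
  ... | true with I i
  ...   | true = ≤-refl
  ...   | false with i ≟ k
  ...     | yes refl rewrite loopless i = ≤-refl
  ...     | no  _ with H i k
  ...       | true  = ≤-refl
  ...       | false = z≤n

AllGraphic : (c₁ c₂ : ℕ) (D : Fin n → ℕ) → Set
AllGraphic {n} c₁ c₂ D = ∀ D′ → Within c₁ c₂ D′ → ∑ D′ ≡ ∑ D →
  ∃[ H ] Symmetric {n} H × Loopless H × (∀ i → row H i ≡ D′ i)

_∖_ : (Y X : Fin n → Bool) → Fin n → Bool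
(Y ∖ X) i = Y i ∧ not (X i)

-- With κ = 0 on K₂ the pairs (K₁ , I₂) and (K₂ , I₂) are nearly tight for B, so
-- D nearly violates the Erdős–Gallai inequality there. Moving degree from
-- I₂ ∖ I₁ to K₂ ∖ K₁ as long as possible gives a sequence in the same region
-- that violates it outright: at (K₁ , I₂) if I₂ ∖ I₁ got exhausted, and at
-- (K₂ , I₂) if K₂ ∖ K₁ did.
module Barrier {c₁ c₂ : ℕ} (1≤c₂ : 1 ≤ c₂) {D ρ κ : Fin n → ℕ}
  (D∈ : Within c₁ c₂ D) (allGraphic : AllGraphic c₁ c₂ D)
  (B : Mat n) (loopless : Loopless B)
  (rows : ∀ i → row B i ≡ D i + ρ i) (cols : ∀ k → col B k ≡ D k + κ k)
  (I₀ I₁ I₂ K₀ K₁ K₂ : Fin n → Bool)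
  (I₀⊆I₁ : ∀ i → I₀ i ≡ true → I₁ i ≡ true) (I₁⊆I₂ : ∀ i → I₁ i ≡ true → I₂ i ≡ true)
  (K₀⊆K₁ : ∀ k → K₀ k ≡ true → K₁ k ≡ true) (K₁⊆K₂ : ∀ k → K₁ k ≡ true → K₂ k ≡ true)
  (zeros₀ : ∀ i k → I₀ i ≡ true → K₀ k ≡ false → B i k ≡ false)
  (zeros₁ : ∀ i k → I₁ i ≡ true → K₁ k ≡ false → B i k ≡ false)
  (zeros₂ : ∀ i k → I₂ i ≡ true → K₂ k ≡ false → B i k ≡ false)
  (ones₁ : ∀ i k → I₁ i ≡ false → K₀ k ≡ true → i ≢ k → B i k ≡ true)
  (ones₂ : ∀ i k → I₂ i ≡ false → K₁ k ≡ true → i ≢ k → B i k ≡ true)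
  (disjoint : Disjoint K₂ I₂)
  {r : Fin n} (r∈I₀ : I₀ r ≡ true) (1≤ρr : 1 ≤ ρ r) (κ≡0 : ∀ k → K₂ k ≡ true → κ k ≡ 0)
  where

  open Within D∈

  private
    K₁-I₂ : Disjoint K₁ I₂
    K₁-I₂ k k∈K = disjoint k (K₁⊆K₂ k k∈K)

    X Y : Fin n → Bool
    X = I₂ ∖ I₁
    Y = K₂ ∖ K₁

    X⊆I₂ : ∀ i → X i ≡ true → I₂ i ≡ true
    X⊆I₂ i p with I₂ i
    ... | true = refl

    Y⊆K₂ : ∀ i → Y i ≡ true → K₂ i ≡ true
    Y⊆K₂ i p with K₂ i
    ... | true = refl

    X-Y : Disjoint X Y
    X-Y i i∈X i∈Y = disjoint i (Y⊆K₂ i i∈Y) (X⊆I₂ i i∈X)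

    ∉X : ∀ i → I₂ i ≡ false → X i ≡ false
    ∉X i p rewrite p = refl

    ∉Y : ∀ i → K₂ i ≡ false → Y i ≡ false
    ∉Y i p rewrite p = refl

    I₁∉X : ∀ i → I₁ i ≡ true → X i ≡ false
    I₁∉X i p rewrite p | I₁⊆I₂ i p = refl

    K₁∉Y : ∀ i → K₁ i ≡ true → Y i ≡ false
    K₁∉Y i p rewrite p | K₁⊆K₂ i p = refl

    ∉-of : {P Q : Fin n → Bool} → Disjoint P Q → ∀ i → P i ≡ true → Q i ≡ false
    ∉-of {Q = Q} d i p with Q i in q
    ... | true  = ⊥-elim (d i p q)
    ... | false = refl

    ∉-of′ : {P Q : Fin n → Bool} → Disjoint P Q → ∀ i → Q i ≡ true → P i ≡ false
    ∉-of′ d = ∉-of λ i q p → d i p q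

    -- By `zeros₀` the row `r` has all its ones in `K₀`, and there are at least `D r` of them.
    c₂≤∣K₀∣ : c₂ ≤ ∑ (⟦_⟧ ∘ K₀)
    c₂≤∣K₀∣ = begin
      c₂             ≤⟨ lower r ⟩
      D r            ≤⟨ m≤m+n _ _ ⟩
      D r + ρ r      ≡⟨ sym (rows r) ⟩
      row B r        ≤⟨ ∑-mono pointwise ⟩
      ∑ (⟦_⟧ ∘ K₀)   ∎
      where
      open ≤-Reasoning
      pointwise : ∀ k → ⟦ B r k ⟧ ≤ ⟦ K₀ k ⟧
      pointwise k with K₀ k in k∈K₀
      ... | true  = ⟦⟧≤1 _
      ... | false rewrite zeros₀ r k r∈I₀ k∈K₀ = z≤n

    -- `K₀` is inhabited, as `c₂` is positive. A column `k` in it has ones in all rows outside `I₁`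
    -- except possibly row `k`, and its sum is `D k` because `κ` vanishes there.
    n≤∣I₁∣+c₁+1 : n ≤ ∑ (⟦_⟧ ∘ I₁) + c₁ + 1
    n≤∣I₁∣+c₁+1 with ∑-positive (⟦_⟧ ∘ K₀) (≤-trans 1≤c₂ c₂≤∣K₀∣)
    ... | k , p with K₀ k in k∈K₀
    ...   | true = begin
      n                                                ≡⟨ sym (*-identityʳ n) ⟩
      n * 1                                            ≡⟨ sym (∑-const n 1) ⟩
      ∑ {n} (λ _ → 1)                                  ≤⟨ ∑-mono pointwise ⟩
      ∑ (λ i → ⟦ I₁ i ⟧ + ⟦ B i k ⟧ + δ k i)           ≡⟨ ∑-distrib-+ (λ i → ⟦ I₁ i ⟧ + ⟦ B i k ⟧) (δ k) ⟩
      ∑ (λ i → ⟦ I₁ i ⟧ + ⟦ B i k ⟧) + ∑ (δ k)         ≡⟨ cong₂ _+_ (∑-distrib-+ (⟦_⟧ ∘ I₁) (λ i → ⟦ B i k ⟧)) (∑-δ k) ⟩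
      ∑ (⟦_⟧ ∘ I₁) + col B k + 1                       ≡⟨ cong (λ z → ∑ (⟦_⟧ ∘ I₁) + z + 1) colk ⟩
      ∑ (⟦_⟧ ∘ I₁) + D k + 1                           ≤⟨ +-monoˡ-≤ 1 (+-monoʳ-≤ _ (upper k)) ⟩
      ∑ (⟦_⟧ ∘ I₁) + c₁ + 1                            ∎
      where
      open ≤-Reasoning
      colk : col B k ≡ D k
      colk = trans (cols k) (trans (cong (D k +_) (κ≡0 k (K₁⊆K₂ k (K₀⊆K₁ k k∈K₀)))) (+-identityʳ _))
      pointwise : ∀ i → 1 ≤ ⟦ I₁ i ⟧ + ⟦ B i k ⟧ + δ k i
      pointwise i with I₁ i in i∈I₁
      ... | true = s≤s z≤n
      ... | false with δ-cases k i
      ...   | inj₁ (_ , q) rewrite q = m≤n+m 1 _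
      ...   | inj₂ (ne , _) rewrite ones₁ i k i∈I₁ k∈K₀ (ne ∘ sym) = s≤s z≤n

    cols-on : ∀ (K : Fin n → Bool) → (∀ k → K k ≡ true → K₂ k ≡ true) →
              ∑ (λ k → ⟦ K k ⟧ * col B k) ≡ ∑ (λ k → ⟦ K k ⟧ * D k)
    cols-on K K⊆K₂ = ∑-cong pointwise
      where
      pointwise : ∀ k → ⟦ K k ⟧ * col B k ≡ ⟦ K k ⟧ * D k
      pointwise k with K k in k∈K
      ... | false = refl
      ... | true rewrite cols k | κ≡0 k (K⊆K₂ k k∈K) = cong (_+ 0) (+-identityʳ (D k))

    rows-on : ∀ (I : Fin n → Bool) → I r ≡ true →
              suc (∑ (λ i → ⟦ I i ⟧ * D i)) ≤ ∑ (λ i → ⟦ I i ⟧ * row B i)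
    rows-on I r∈I = ∑-mono-< pointwise r strict
      where
      pointwise : ∀ i → ⟦ I i ⟧ * D i ≤ ⟦ I i ⟧ * row B i
      pointwise i rewrite rows i = *-monoʳ-≤ ⟦ I i ⟧ (m≤m+n (D i) (ρ i))
      strict : ⟦ I r ⟧ * D r < ⟦ I r ⟧ * row B r
      strict rewrite r∈I | rows r = +-monoˡ-≤ 0 (≤-trans (≤-reflexive (+-comm 1 (D r))) (+-monoʳ-≤ (D r) 1≤ρr))

    r∈I₁ : I₁ r ≡ true
    r∈I₁ = I₀⊆I₁ r r∈I₀
    r∈I₂ : I₂ r ≡ true
    r∈I₂ = I₁⊆I₂ r r∈I₁

    -- The ones in the columns of `K₁` are counted by rows: rows outside `I₂` are full there off the
    -- diagonal, rows of `I₁` have all their ones there, and rows of `X` are full at least on `K₀`.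
    count-low : cells K₁ I₂ + ∑ (λ i → ⟦ I₁ i ⟧ * row B i) + ∑ (λ i → ⟦ X i ⟧ * ∑ (⟦_⟧ ∘ K₀))
                ≤ ∑ (λ k → ⟦ K₁ k ⟧ * col B k)
    count-low = begin
      cells K₁ I₂ + ∑ (λ i → ⟦ I₁ i ⟧ * row B i) + ∑ (λ i → ⟦ X i ⟧ * ∑ (⟦_⟧ ∘ K₀))
        ≡⟨ cong₂ (λ a b → cells K₁ I₂ + a + b) (sym (∑-rows (⟦_⟧ ∘ I₁) (λ i k → ⟦ B i k ⟧))) (sym (∑-rows (⟦_⟧ ∘ X) (λ i k → ⟦ K₀ k ⟧))) ⟩
      cells K₁ I₂ + ∑ (λ i → ∑ λ k → ⟦ I₁ i ⟧ * ⟦ B i k ⟧) + ∑ (λ i → ∑ λ k → ⟦ X i ⟧ * ⟦ K₀ k ⟧)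
        ≡⟨ cong (_+ ∑ (λ i → ∑ λ k → ⟦ X i ⟧ * ⟦ K₀ k ⟧)) (sym (∑∑-distrib-+ f g)) ⟩
      ∑ (λ i → ∑ λ k → f i k + g i k) + ∑ (λ i → ∑ λ k → ⟦ X i ⟧ * ⟦ K₀ k ⟧)
        ≡⟨ sym (∑∑-distrib-+ (λ i k → f i k + g i k) (λ i k → ⟦ X i ⟧ * ⟦ K₀ k ⟧)) ⟩
      ∑ (λ i → ∑ λ k → f i k + g i k + ⟦ X i ⟧ * ⟦ K₀ k ⟧)
        ≤⟨ ∑∑-mono pointwise ⟩
      ∑ (λ i → ∑ λ k → ⟦ K₁ k ⟧ * ⟦ B i k ⟧)
        ≡⟨ ∑-cols (⟦_⟧ ∘ K₁) (λ i k → ⟦ B i k ⟧) ⟩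
      ∑ (λ k → ⟦ K₁ k ⟧ * col B k) ∎
      where
      open ≤-Reasoning
      f g : Fin n → Fin n → ℕ
      f i k = ⟦ K₁ k ∧ not (I₂ i) ∧ not (does (i ≟ k)) ⟧
      g i k = ⟦ I₁ i ⟧ * ⟦ B i k ⟧
      pointwise : ∀ i k → ⟦ K₁ k ∧ not (I₂ i) ∧ not (does (i ≟ k)) ⟧ + ⟦ I₁ i ⟧ * ⟦ B i k ⟧ + ⟦ X i ⟧ * ⟦ K₀ k ⟧
                          ≤ ⟦ K₁ k ⟧ * ⟦ B i k ⟧
      pointwise i k with I₁ i in i∈I₁ | I₂ i in i∈I₂
      ... | true | false = ⊥-elim (clash (I₁⊆I₂ i i∈I₁) i∈I₂)
      ... | false | false with K₁ k in k∈K₁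
      ...   | false = ≤-refl
      ...   | true with i ≟ k
      ...     | yes _ = z≤n
      ...     | no ne rewrite ones₂ i k i∈I₂ k∈K₁ ne = ≤-refl
      pointwise i k | true | true with K₁ k in k∈K₁
      ...   | true = ≤-reflexive (+-identityʳ _)
      ...   | false rewrite zeros₁ i k i∈I₁ k∈K₁ = ≤-refl
      pointwise i k | false | true with K₀ k in k∈K₀
      ...   | true rewrite K₀⊆K₁ k k∈K₀
                | ones₁ i k i∈I₁ k∈K₀ (λ { refl → K₁-I₂ i (K₀⊆K₁ i k∈K₀) i∈I₂ }) = ≤-refl
      ...   | false with K₁ k
      ...     | true  = z≤n
      ...     | false = z≤n

    -- In a column of `Y` each of the `n` entries is charged at most once: in a row of `I₁` it is
    -- zero and counts for |I₁|, in a row of `X` it is at most one, outside `I₂` it is a cell or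
    -- lies on the diagonal. The last |Y| on the left stands for the diagonal. In the columns of
    -- `K₁` the cells are filled, and outside `K₂` the rows of `I₂` are zero.
    count-high : ∑ (λ i → ⟦ I₂ i ⟧ * row B i) + cells K₂ I₂ + ∑ (λ k → ⟦ Y k ⟧ * ∑ (⟦_⟧ ∘ I₁)) + ∑ (⟦_⟧ ∘ Y)
                 ≤ ∑ (λ k → ⟦ K₁ k ⟧ * col B k) + ∑ (λ k → ⟦ Y k ⟧ * n)
    count-high = begin
      ∑ (λ i → ⟦ I₂ i ⟧ * row B i) + cells K₂ I₂ + ∑ (λ k → ⟦ Y k ⟧ * ∑ (⟦_⟧ ∘ I₁)) + ∑ (⟦_⟧ ∘ Y)
        ≡⟨ cong₂ _+_ (cong₂ (λ a b → a + cells K₂ I₂ + b) (sym (∑-rows (⟦_⟧ ∘ I₂) (λ i k → ⟦ B i k ⟧)))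
             (sym (∑-cols (⟦_⟧ ∘ Y) (λ i k → ⟦ I₁ i ⟧))))
             (trans (∑-cong λ k → trans (sym (*-identityʳ _)) (cong (⟦ Y k ⟧ *_) (sym (∑-δ k)))) (trans
               (∑-cong λ k → cong (⟦ Y k ⟧ *_) (∑-cong λ i → δ-sym k i)) (sym (∑-cols (⟦_⟧ ∘ Y) δ)))) ⟩
      ∑∑ f + ∑∑ g + ∑∑ h + ∑∑ e
        ≡⟨ cong (λ z → z + ∑∑ h + ∑∑ e) (sym (∑∑-distrib-+ f g)) ⟩
      ∑∑ (λ i k → f i k + g i k) + ∑∑ h + ∑∑ e
        ≡⟨ cong (_+ ∑∑ e) (sym (∑∑-distrib-+ (λ i k → f i k + g i k) h)) ⟩
      ∑∑ (λ i k → f i k + g i k + h i k) + ∑∑ e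
        ≡⟨ sym (∑∑-distrib-+ (λ i k → f i k + g i k + h i k) e) ⟩
      ∑∑ (λ i k → f i k + g i k + h i k + e i k)
        ≤⟨ ∑∑-mono pointwise ⟩
      ∑∑ (λ i k → ⟦ K₁ k ⟧ * ⟦ B i k ⟧ + ⟦ Y k ⟧ * 1)
        ≡⟨ ∑∑-distrib-+ (λ i k → ⟦ K₁ k ⟧ * ⟦ B i k ⟧) (λ i k → ⟦ Y k ⟧ * 1) ⟩
      ∑∑ (λ i k → ⟦ K₁ k ⟧ * ⟦ B i k ⟧) + ∑∑ (λ i k → ⟦ Y k ⟧ * 1)
        ≡⟨ cong₂ _+_ (∑-cols (⟦_⟧ ∘ K₁) (λ i k → ⟦ B i k ⟧))
             (trans (∑-cols (⟦_⟧ ∘ Y) (λ _ _ → 1)) (∑-cong λ k → cong (⟦ Y k ⟧ *_) (trans (∑-const n 1) (*-identityʳ n)))) ⟩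
      ∑ (λ k → ⟦ K₁ k ⟧ * col B k) + ∑ (λ k → ⟦ Y k ⟧ * n) ∎
      where
      open ≤-Reasoning
      ∑∑ : (Fin n → Fin n → ℕ) → ℕ
      ∑∑ f = ∑ λ i → ∑ (f i)
      f g h e : Fin n → Fin n → ℕ
      f i k = ⟦ I₂ i ⟧ * ⟦ B i k ⟧
      g i k = ⟦ K₂ k ∧ not (I₂ i) ∧ not (does (i ≟ k)) ⟧
      h i k = ⟦ Y k ⟧ * ⟦ I₁ i ⟧
      e i k = ⟦ Y k ⟧ * δ i k
      drop-zero : ∀ x → x + 0 + 0 ≡ x
      drop-zero = solve-∀
      drop-zeros : ∀ x → x + 0 + 0 + 0 + 0 ≡ x + 0 + 0
      drop-zeros = solve-∀
      pointwise : ∀ i k → ⟦ I₂ i ⟧ * ⟦ B i k ⟧ + ⟦ K₂ k ∧ not (I₂ i) ∧ not (does (i ≟ k)) ⟧ + ⟦ Y k ⟧ * ⟦ I₁ i ⟧ + ⟦ Y k ⟧ * δ i k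
                          ≤ ⟦ K₁ k ⟧ * ⟦ B i k ⟧ + ⟦ Y k ⟧ * 1
      pointwise i k with K₁ k in k∈K₁ | K₂ k in k∈K₂
      ... | true | false = ⊥-elim (clash (K₁⊆K₂ k k∈K₁) k∈K₂)
      ... | false | false with I₂ i in i∈I₂
      ...   | false = ≤-refl
      ...   | true rewrite zeros₂ i k i∈I₂ k∈K₂ = ≤-refl
      pointwise i k | true | true with I₂ i in i∈I₂
      ...   | true = ≤-reflexive (drop-zeros ⟦ B i k ⟧)
      ...   | false with i ≟ k
      ...     | yes _ = z≤n
      ...     | no ne rewrite ones₂ i k i∈I₂ k∈K₁ ne = ≤-refl
      pointwise i k | false | true with I₁ i in i∈I₁ | I₂ i in i∈I₂
      ...   | true | false = ⊥-elim (clash (I₁⊆I₂ i i∈I₁) i∈I₂)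
      ...   | true | true rewrite zeros₁ i k i∈I₁ k∈K₁ | δ-diff {i = i} {k} (λ { refl → disjoint i k∈K₂ i∈I₂ }) = ≤-refl
      ...   | false | true rewrite δ-diff {i = i} {k} (λ { refl → disjoint i k∈K₂ i∈I₂ }) =
                ≤-trans (≤-reflexive (trans (drop-zeros ⟦ B i k ⟧) (drop-zero ⟦ B i k ⟧))) (⟦⟧≤1 (B i k))
      ...   | false | false with i ≟ k
      ...     | yes _ = ≤-refl
      ...     | no _  = ≤-refl

    module _ (D′ : Fin n → ℕ) (s : Shifted c₁ c₂ X Y D D′) where
      open Shifted s

      K₁-unchanged : ∀ k → K₁ k ≡ true → D′ k ≡ D k
      K₁-unchanged k p = unchanged k (∉X k (∉-of disjoint k (K₁⊆K₂ k p))) (K₁∉Y k p)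

      I₁-unchanged : ∀ i → I₁ i ≡ true → D′ i ≡ D i
      I₁-unchanged i p = unchanged i (I₁∉X i p) (∉Y i (∉-of′ disjoint i (I₁⊆I₂ i p)))

      -- A row of `X` now needs only `c₂`, no more than the |K₀| ones that `count-low` finds in it.
      -- Strictness comes from the excess in row `r`.
      low-violates : (∀ i → X i ≡ true → D′ i ≡ c₂) →
                     cells K₁ I₂ + ∑ (λ i → ⟦ I₂ i ⟧ * D′ i) < ∑ (λ k → ⟦ K₁ k ⟧ * D′ k)
      low-violates X-low = begin-strict
        cells K₁ I₂ + ∑ (λ i → ⟦ I₂ i ⟧ * D′ i)
          ≡⟨ cong (cells K₁ I₂ +_) (∑-cong split) ⟩
        cells K₁ I₂ + ∑ (λ i → ⟦ I₁ i ⟧ * D i + ⟦ X i ⟧ * c₂)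
          ≡⟨ cong (cells K₁ I₂ +_) (∑-distrib-+ (λ i → ⟦ I₁ i ⟧ * D i) (λ i → ⟦ X i ⟧ * c₂)) ⟩
        cells K₁ I₂ + (∑ (λ i → ⟦ I₁ i ⟧ * D i) + ∑ (λ i → ⟦ X i ⟧ * c₂))
          ≡⟨ sym (+-assoc (cells K₁ I₂) _ _) ⟩
        cells K₁ I₂ + ∑ (λ i → ⟦ I₁ i ⟧ * D i) + ∑ (λ i → ⟦ X i ⟧ * c₂)
          <⟨ +-mono-<-≤ (+-monoʳ-< (cells K₁ I₂) (rows-on I₁ r∈I₁)) (∑-mono λ i → *-monoʳ-≤ ⟦ X i ⟧ c₂≤∣K₀∣) ⟩
        cells K₁ I₂ + ∑ (λ i → ⟦ I₁ i ⟧ * row B i) + ∑ (λ i → ⟦ X i ⟧ * ∑ (⟦_⟧ ∘ K₀))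
          ≤⟨ count-low ⟩
        ∑ (λ k → ⟦ K₁ k ⟧ * col B k)
          ≡⟨ cols-on K₁ K₁⊆K₂ ⟩
        ∑ (λ k → ⟦ K₁ k ⟧ * D k)
          ≡⟨ ∑-cong same ⟩
        ∑ (λ k → ⟦ K₁ k ⟧ * D′ k) ∎
        where
        open ≤-Reasoning
        same : ∀ k → ⟦ K₁ k ⟧ * D k ≡ ⟦ K₁ k ⟧ * D′ k
        same k with K₁ k in p
        ... | false = refl
        ... | true rewrite K₁-unchanged k p = refl
        split : ∀ i → ⟦ I₂ i ⟧ * D′ i ≡ ⟦ I₁ i ⟧ * D i + ⟦ X i ⟧ * c₂
        split i with I₁ i in p | I₂ i in q | X-low i
        ... | true  | false | _ = ⊥-elim (clash (I₁⊆I₂ i p) q)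
        ... | true  | true  | _ rewrite I₁-unchanged i p = sym (+-identityʳ _)
        ... | false | false | _ = refl
        ... | false | true  | low = cong (_+ 0) (low refl)

      -- By `count-high`, a violation requires a column of `Y` to carry n - |I₁| - 1, and `D′` has
      -- `c₁` there, which is at least as much. The terms for |I₁| and the diagonal stand on both
      -- sides to avoid truncated subtraction.
      high-violates : (∀ i → Y i ≡ true → D′ i ≡ c₁) →
                      cells K₂ I₂ + ∑ (λ i → ⟦ I₂ i ⟧ * D′ i) < ∑ (λ k → ⟦ K₂ k ⟧ * D′ k)
      high-violates Y-high = +-cancelʳ-< (∑ (λ k → ⟦ Y k ⟧ * ∑ (⟦_⟧ ∘ I₁)) + ∑ (⟦_⟧ ∘ Y)) _ _ (begin-strict
        cells K₂ I₂ + ∑ (λ i → ⟦ I₂ i ⟧ * D′ i) + (∑ (λ k → ⟦ Y k ⟧ * ∑ (⟦_⟧ ∘ I₁)) + ∑ (⟦_⟧ ∘ Y))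
          ≤⟨ +-monoˡ-≤ _ (+-monoʳ-≤ (cells K₂ I₂) (∑-mono lower-I)) ⟩
        cells K₂ I₂ + ∑ (λ i → ⟦ I₂ i ⟧ * D i) + (∑ (λ k → ⟦ Y k ⟧ * ∑ (⟦_⟧ ∘ I₁)) + ∑ (⟦_⟧ ∘ Y))
          <⟨ +-monoˡ-< _ (+-monoʳ-< (cells K₂ I₂) (rows-on I₂ r∈I₂)) ⟩
        cells K₂ I₂ + ∑ (λ i → ⟦ I₂ i ⟧ * row B i) + (∑ (λ k → ⟦ Y k ⟧ * ∑ (⟦_⟧ ∘ I₁)) + ∑ (⟦_⟧ ∘ Y))
          ≡⟨ rearrange (cells K₂ I₂) _ _ _ ⟩
        ∑ (λ i → ⟦ I₂ i ⟧ * row B i) + cells K₂ I₂ + ∑ (λ k → ⟦ Y k ⟧ * ∑ (⟦_⟧ ∘ I₁)) + ∑ (⟦_⟧ ∘ Y)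
          ≤⟨ count-high ⟩
        ∑ (λ k → ⟦ K₁ k ⟧ * col B k) + ∑ (λ k → ⟦ Y k ⟧ * n)
          ≡⟨ cong (_+ ∑ (λ k → ⟦ Y k ⟧ * n)) (cols-on K₁ K₁⊆K₂) ⟩
        ∑ (λ k → ⟦ K₁ k ⟧ * D k) + ∑ (λ k → ⟦ Y k ⟧ * n)
          ≤⟨ +-monoʳ-≤ _ (∑-mono λ k → *-monoʳ-≤ ⟦ Y k ⟧ n≤∣I₁∣+c₁+1) ⟩
        ∑ (λ k → ⟦ K₁ k ⟧ * D k) + ∑ (λ k → ⟦ Y k ⟧ * (∑ (⟦_⟧ ∘ I₁) + c₁ + 1))
          ≡⟨ sym (∑-distrib-+ (λ k → ⟦ K₁ k ⟧ * D k) (λ k → ⟦ Y k ⟧ * (∑ (⟦_⟧ ∘ I₁) + c₁ + 1))) ⟩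
        ∑ (λ k → ⟦ K₁ k ⟧ * D k + ⟦ Y k ⟧ * (∑ (⟦_⟧ ∘ I₁) + c₁ + 1))
          ≡⟨ ∑-cong split ⟩
        ∑ (λ k → ⟦ K₂ k ⟧ * D′ k + (⟦ Y k ⟧ * ∑ (⟦_⟧ ∘ I₁) + ⟦ Y k ⟧))
          ≡⟨ ∑-distrib-+ (λ k → ⟦ K₂ k ⟧ * D′ k) (λ k → ⟦ Y k ⟧ * ∑ (⟦_⟧ ∘ I₁) + ⟦ Y k ⟧) ⟩
        ∑ (λ k → ⟦ K₂ k ⟧ * D′ k) + ∑ (λ k → ⟦ Y k ⟧ * ∑ (⟦_⟧ ∘ I₁) + ⟦ Y k ⟧)
          ≡⟨ cong (∑ (λ k → ⟦ K₂ k ⟧ * D′ k) +_) (∑-distrib-+ (λ k → ⟦ Y k ⟧ * ∑ (⟦_⟧ ∘ I₁)) (⟦_⟧ ∘ Y)) ⟩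
        ∑ (λ k → ⟦ K₂ k ⟧ * D′ k) + (∑ (λ k → ⟦ Y k ⟧ * ∑ (⟦_⟧ ∘ I₁)) + ∑ (⟦_⟧ ∘ Y)) ∎)
        where
        open ≤-Reasoning
        rearrange : ∀ a b c d → a + b + (c + d) ≡ b + a + c + d
        rearrange = solve-∀
        expand : ∀ d i c → d * 0 + 1 * (i + c + 1) ≡ 1 * c + (1 * i + 1)
        expand = solve-∀
        lower-I : ∀ i → ⟦ I₂ i ⟧ * D′ i ≤ ⟦ I₂ i ⟧ * D i
        lower-I i with I₁ i in p | I₂ i in q | lowered i
        ... | _     | false | _ = z≤n
        ... | true  | true  | _ = ≤-reflexive (cong (_+ 0) (I₁-unchanged i p))
        ... | false | true  | low = +-monoˡ-≤ 0 (low refl)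
        split : ∀ k → ⟦ K₁ k ⟧ * D k + ⟦ Y k ⟧ * (∑ (⟦_⟧ ∘ I₁) + c₁ + 1)
                      ≡ ⟦ K₂ k ⟧ * D′ k + (⟦ Y k ⟧ * ∑ (⟦_⟧ ∘ I₁) + ⟦ Y k ⟧)
        split k with K₁ k in p | K₂ k in q | Y-high k
        ... | true  | false | _ = ⊥-elim (clash (K₁⊆K₂ k p) q)
        ... | true  | true  | _ rewrite K₁-unchanged k p = refl
        ... | false | false | _ = refl
        ... | false | true  | high rewrite high refl = expand 0 (∑ (⟦_⟧ ∘ I₁)) c₁

  absurd : ⊥
  absurd with D′ , s ← shiftDegrees X-Y D D∈
    with H , H-sym , H-loopless , H-rows ← allGraphic D′ (Shifted.bounds s) (Shifted.total s) =
    conclude (Shifted.exhausted s)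
    where
    bound : ∀ K → ∑ (λ k → ⟦ K k ⟧ * D′ k) ≤ cells K I₂ + ∑ (λ i → ⟦ I₂ i ⟧ * D′ i)
    bound K = subst₂ (λ a b → a ≤ cells K I₂ + b) (∑-cong λ k → cong (⟦ K k ⟧ *_) (H-rows k))
      (∑-cong λ i → cong (⟦ I₂ i ⟧ *_) (H-rows i)) (erdős-gallai H H-sym H-loopless K I₂)
    conclude : (∀ i → X i ≡ true → D′ i ≡ c₂) ⊎ (∀ i → Y i ≡ true → D′ i ≡ c₁) → ⊥
    conclude (inj₁ X-low)  = <⇒≱ (low-violates D′ s X-low) (bound K₁)
    conclude (inj₂ Y-high) = <⇒≱ (high-violates D′ s Y-high) (bound K₂)

-- Alternating reachability

-- Alternating reachability from the rows with ρ > 0: a row i leads to the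
-- columns k with B i k = 1, and a column k to the rows i with B i k = 0.
module Reach {n} (B : Mat n) (ρ : Fin n → ℕ) where

  below? : (J : Fin n → Bool) → ∀ k → Dec (∃[ i ] J i ≡ true × B i k ≡ true)
  below? J k = any? λ i → (J i ≟ᵇ true) ×-dec (B i k ≟ᵇ true)

  -- The condition `i ≢ k` keeps walks off the diagonal, whose zeros must not be filled.
  beside? : (L : Fin n → Bool) → ∀ i → Dec (∃[ k ] L k ≡ true × i ≢ k × B i k ≡ false)
  beside? L i = any? λ k → (L k ≟ᵇ true) ×-dec ¬? (i ≟ k) ×-dec (B i k ≟ᵇ false)

  abstract
    I K : ℕ → Fin n → Bool
    I zero    i = does (1 ≤? ρ i)
    I (suc t) i = I t i ∨ does (beside? (K t) i)
    K t k = does (below? (I t) k)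

    K-intro : ∀ t {i k} → I t i ≡ true → B i k ≡ true → K t k ≡ true
    K-intro t {i} {k} p q = dec-true (below? (I t) k) (i , p , q)

    K-elim : ∀ t {k} → K t k ≡ true → ∃[ i ] I t i ≡ true × B i k ≡ true
    K-elim t {k} = from-does (below? (I t) k)

    I-mono : ∀ t {i} → I t i ≡ true → I (suc t) i ≡ true
    I-mono t p rewrite p = refl

    I-intro : ∀ t {i k} → K t k ≡ true → i ≢ k → B i k ≡ false → I (suc t) i ≡ true
    I-intro t {i} {k} p ne q with I t i
    ... | true  = refl
    ... | false = dec-true (beside? (K t) i) (k , p , ne , q)

    I-elim : ∀ t {i} → I (suc t) i ≡ true → I t i ≡ false →
             ∃[ k ] K t k ≡ true × i ≢ k × B i k ≡ false
    I-elim t {i} p q rewrite q = from-does (beside? (K t) i) p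

    I₀-intro : ∀ {i} → 1 ≤ ρ i → I 0 i ≡ true
    I₀-intro {i} = dec-true (1 ≤? ρ i)

    I₀-elim : ∀ {i} → I 0 i ≡ true → 1 ≤ ρ i
    I₀-elim {i} = from-does (1 ≤? ρ i)

  K-mono : ∀ t {k} → K t k ≡ true → K (suc t) k ≡ true
  K-mono t p with i , q , r ← K-elim t p = K-intro (suc t) (I-mono t q) r

  I-mono* : ∀ {s t} → s ≤ t → ∀ {i} → I s i ≡ true → I t i ≡ true
  I-mono* {s} {t} s≤t p = go (≤⇒≤′ s≤t)
    where
    go : ∀ {t} → s ≤′ t → I t _ ≡ true
    go (≤′-reflexive refl) = p
    go (≤′-step {t} s≤t)   = I-mono t (go s≤t)

  K-mono* : ∀ {s t} → s ≤ t → ∀ {k} → K s k ≡ true → K t k ≡ true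
  K-mono* {s} {t} s≤t p with i , q , r ← K-elim s p = K-intro t (I-mono* s≤t q) r

  zeros : ∀ t i k → I t i ≡ true → K t k ≡ false → B i k ≡ false
  zeros t i k p q with B i k in r
  ... | true  = ⊥-elim (clash (K-intro t p r) q)
  ... | false = refl

  ones : ∀ t i k → I (suc t) i ≡ false → K t k ≡ true → i ≢ k → B i k ≡ true
  ones t i k p q ne with B i k in r
  ... | true  = refl
  ... | false = ⊥-elim (clash (I-intro t q ne r) p)

  record Augmented (B′ : Mat n) (k : Fin n) (size : ℕ) : Set where
    field
      root     : Fin n
      is-root  : 1 ≤ ρ root
      result   : Mat n
      support  : List (Fin n)
      small    : length support ≤ size
      close    : Close support B′ result
      loopless : Loopless result
      rows     : ∀ a → row result a + δ root a ≡ row B′ a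
      cols     : ∀ c → col result c + δ k c ≡ col B′ c

  private
    off-square : ∀ {S} (i k : Fin n) v B → i ∈ₗ S → k ∈ₗ S → Close S B (set i k v B)
    off-square i k v B p q a c with a ≟ i | c ≟ k
    ... | yes refl | yes refl = inj₁ (p , q)
    ... | yes _    | no _     = inj₂ refl
    ... | no _     | yes _    = inj₂ refl
    ... | no _     | no _     = inj₂ refl

    set-loopless : ∀ (i k : Fin n) v B → Loopless B → (i ≡ k → v ≡ false) → Loopless (set i k v B)
    set-loopless i k v B loopless ok a with a ≟ i | a ≟ k
    ... | yes refl | yes refl = ok refl
    ... | yes _    | no _     = loopless a
    ... | no _     | yes _    = loopless a
    ... | no _     | no _     = loopless a

  -- An alternating walk ending in column k is traced back from k. Each step
  -- changes a row outside I t, so that the rest of the walk stays available.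
  augment : ∀ t (B′ : Mat n) → Loopless B′ → (∀ i c → I t i ≡ true → B′ i c ≡ B i c) →
            ∀ {k} → K t k ≡ true → Augmented B′ k (2 + 3 * t)
  augment-from-row : ∀ t (B′ : Mat n) → Loopless B′ → (∀ i c → I t i ≡ true → B′ i c ≡ B i c) →
                     ∀ {i k} → I t i ≡ true → B i k ≡ true → Augmented B′ k (2 + 3 * t)

  augment t B′ loopless same k∈K with i , i∈I , Bik ← K-elim t k∈K =
    augment-from-row t B′ loopless same i∈I Bik

  augment-from-row zero B′ loopless same {i} {k} i∈I Bik = record
    { root = i ; is-root = I₀-elim i∈I
    ; result = set i k false B′ ; support = i ∷ k ∷ [] ; small = ≤-refl
    ; close = off-square i k false B′ (here refl) (there (here refl))
    ; loopless = set-loopless i k false B′ loopless (λ _ → refl)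
    ; rows = row-drop B′ _ i k (λ a c ne → sym (set-diff i k false B′ a c ne))
               (trans (same i k i∈I) Bik) (set-same i k false B′)
    ; cols = col-drop B′ _ i k (λ a c ne → sym (set-diff i k false B′ a c ne))
               (trans (same i k i∈I) Bik) (set-same i k false B′) }
  augment-from-row (suc t) B′ loopless same {i} {k} i∈I⁺ Bik with dichotomy (I t i)
  ... | inj₁ i∈I = record
    { Augmented aug hiding (small) ; small = ≤-trans (Augmented.small aug) (+-monoʳ-≤ 2 (*-monoʳ-≤ 3 (n≤1+n t))) }
    where aug = augment-from-row t B′ loopless (λ a c p → same a c (I-mono t p)) i∈I Bik
  ... | inj₂ i∉I with I-elim t i∈I⁺ i∉I
  -- Clearing `i k` and filling `i j` preserves the sum of row `i` and hands the excess of column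
  -- `k` on to column `j`, where the recursion removes it. A level costs the three vertices `i`,
  -- `k`, `j` and the final clearing two, hence `2 + 3 * t`.
  ...   | j , j∈K , i≢j , Bij = record
    { Augmented aug hiding (support; small; close; rows; cols)
    ; support = i ∷ k ∷ j ∷ support
    ; small = subst (3 + length support ≤_) (size t) (+-monoʳ-≤ 3 small)
    ; close = Close-trans (i ∷ k ∷ j ∷ []) support
        (Close-trans′ (off-square i k false B′ (here refl) (there (here refl)))
                      (off-square i j true B₁ (here refl) (there (there (here refl))))) close
    ; rows = λ a → trans (rows a) (trans (sym (rows₂ a)) (rows₁ a))
    ; cols = λ c → trans (swap-last _ (δ j c) (δ k c) (cols c) (cols₂ c)) (cols₁ c) }
    where
    B₁ B₂ : Mat n
    B₁ = set i k false B′
    B₂ = set i j true B₁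

    B′ik : B′ i k ≡ true
    B′ik = trans (same i k i∈I⁺) Bik

    j≢k : j ≢ k
    j≢k refl = clash Bik Bij

    B₁ij : B₁ i j ≡ false
    B₁ij = trans (set-diff i k false B′ i j (λ (_ , p) → j≢k p)) (trans (same i j i∈I⁺) Bij)

    untouched : ∀ a c → I t a ≡ true → B₂ a c ≡ B a c
    untouched a c p = trans (set-diff i j true B₁ a c off) (trans (set-diff i k false B′ a c off) (same a c (I-mono t p)))
      where
      off : ∀ {x} → ¬ (a ≡ i × c ≡ x)
      off (refl , _) = clash p i∉I

    aug = augment t B₂
      (set-loopless i j true B₁ (set-loopless i k false B′ loopless (λ _ → refl)) (λ p → ⊥-elim (i≢j p)))
      untouched j∈K
    open Augmented aug

    rows₁ : ∀ a → row B₁ a + δ i a ≡ row B′ a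
    rows₁ = row-drop B′ B₁ i k (λ a c ne → sym (set-diff i k false B′ a c ne)) B′ik (set-same i k false B′)
    cols₁ : ∀ c → col B₁ c + δ k c ≡ col B′ c
    cols₁ = col-drop B′ B₁ i k (λ a c ne → sym (set-diff i k false B′ a c ne)) B′ik (set-same i k false B′)
    rows₂ : ∀ a → row B₁ a + δ i a ≡ row B₂ a
    rows₂ = row-drop B₂ B₁ i j (λ a c ne → set-diff i j true B₁ a c ne) (set-same i j true B₁) B₁ij
    cols₂ : ∀ c → col B₁ c + δ j c ≡ col B₂ c
    cols₂ = col-drop B₂ B₁ i j (λ a c ne → set-diff i j true B₁ a c ne) (set-same i j true B₁) B₁ij

    swap-last : ∀ x y z {b₁ b₂} → x + y ≡ b₂ → b₁ + y ≡ b₂ → x + z ≡ b₁ + z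
    swap-last x y z p q = cong (_+ z) (+-cancelʳ-≡ y x _ (trans p (sym q)))

    size : ∀ t → 3 + (2 + 3 * t) ≡ 2 + 3 * suc t
    size = solve-∀

-- Existence of short walks

∑∑-mono-< : {f g : Fin n → Fin n → ℕ} → (∀ i k → f i k ≤ g i k) → ∀ i k → f i k < g i k →
            ∑ (λ i → ∑ (f i)) < ∑ (λ i → ∑ (g i))
∑∑-mono-< f≤g i k f<g = ∑-mono-< (λ i → ∑-mono (f≤g i)) i (∑-mono-< (f≤g i) k f<g)

antitone-stalls : ∀ m (f : ℕ → ℕ) → (∀ s → f (suc s) ≤ f s) → f 0 ≤ m → ∃[ s ] s ≤ m × f (suc s) ≡ f s
antitone-stalls m f anti f0≤m with m≤n⇒m<n∨m≡n (anti 0)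
... | inj₂ eq = 0 , z≤n , eq
antitone-stalls zero    f anti f0≤m | inj₁ lt = ⊥-elim (<⇒≱ lt (≤-trans f0≤m z≤n))
antitone-stalls (suc m) f anti f0≤m | inj₁ lt
  with s , s≤m , eq ← antitone-stalls m (f ∘ suc) (anti ∘ suc) (≤-pred (≤-trans lt f0≤m)) =
  suc s , s≤s s≤m , eq

∑-members : (S : List (Fin n)) (R : Fin n → Bool) → (∀ y → R y ≡ true → y ∈ₗ S) → ∑ (⟦_⟧ ∘ R) ≤ length S
∑-members {n} S R R⊆S = ≤-trans (∑-mono pointwise) (≤-reflexive (total S))
  where
  multiplicity : List (Fin n) → Fin n → ℕ
  multiplicity []       y = 0
  multiplicity (x ∷ xs) y = δ x y + multiplicity xs y
  total : ∀ xs → ∑ (multiplicity xs) ≡ length xs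
  total []       = ∑-zero {n} λ _ → refl
  total (x ∷ xs) = trans (∑-distrib-+ (δ x) (multiplicity xs)) (cong₂ _+_ (∑-δ x) (total xs))
  member : ∀ {y} xs → y ∈ₗ xs → 1 ≤ multiplicity xs y
  member {y} (x ∷ xs) (here refl) rewrite δ-same y = s≤s z≤n
  member {y} (x ∷ xs) (there y∈xs) = ≤-trans (member xs y∈xs) (m≤n+m _ (δ x y))
  pointwise : ∀ y → ⟦ R y ⟧ ≤ multiplicity S y
  pointwise y with R y in y∈R
  ... | true  = member S (R⊆S y y∈R)
  ... | false = z≤n

-- If no column with κ > 0 is reached, there are two cases. When K 2 and I 2 are
-- disjoint, they form a barrier. Otherwise nearly symmetric B makes every vertex
-- reached after boundedly many levels, and the complements of the reached sets,
-- taken in reverse order, form a barrier for the transpose of B.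
module Stage {c₁ c₂ : ℕ} (1≤c₂ : 1 ≤ c₂) {D ρ κ : Fin n → ℕ}
  (D∈ : Within c₁ c₂ D) (allGraphic : AllGraphic c₁ c₂ D)
  {A B : Mat n} (A-sym : Symmetric A) {S : List (Fin n)} (close : Close S A B) (loopless : Loopless B)
  (rows : ∀ i → row B i ≡ D i + ρ i) (cols : ∀ k → col B k ≡ D k + κ k)
  where

  open Reach B ρ

  asymmetric⇒∈ : ∀ {x y} → B x y ≡ false → B y x ≡ true → y ∈ₗ S
  asymmetric⇒∈ {x} {y} p q with close x y | close y x
  ... | inj₁ (_ , y∈S) | _ = y∈S
  ... | inj₂ _  | inj₁ (y∈S , _) = y∈S
  ... | inj₂ xy | inj₂ yx = ⊥-elim (clash (trans (sym xy) (trans (A-sym x y) (trans yx q))) p)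

  -- The vertices reached neither as a row nor as a column. `R s` being empty is the disjointness
  -- that a barrier for the transpose demands.
  R : ℕ → Fin n → Bool
  R s y = not (K s y) ∧ not (I s y)

  R-elim : ∀ s {y} → R s y ≡ true → K s y ≡ false × I s y ≡ false
  R-elim s {y} p with K s y | I s y
  ... | false | false = refl , refl

  R-intro : ∀ s {y} → K s y ≡ false → I s y ≡ false → R s y ≡ true
  R-intro s p q rewrite p | q = refl

  ¬mono : ∀ {a b : Bool} → (a ≡ true → b ≡ true) → b ≡ false → a ≡ false
  ¬mono {true}  f p = ⊥-elim (clash (f refl) p)
  ¬mono {false} f p = refl

  R-anti : ∀ s {y} → R (suc s) y ≡ true → R s y ≡ true
  R-anti s p with q , r ← R-elim (suc s) p = R-intro s (¬mono (K-mono s) q) (¬mono (I-mono s) r)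

  R-≤ : ∀ s y → ⟦ R (suc s) y ⟧ ≤ ⟦ R s y ⟧
  R-≤ s y with R (suc s) y in p
  ... | true rewrite R-anti s p = ≤-refl
  ... | false = z≤n

  ∣R∣ : ℕ → ℕ
  ∣R∣ s = ∑ (⟦_⟧ ∘ R s)

  stalled : ∀ s → ∣R∣ (suc s) ≡ ∣R∣ s → ∀ y → R s y ≡ true → R (suc s) y ≡ true
  stalled s eq y p with R (suc s) y in q
  ... | true  = refl
  ... | false = ⊥-elim (<⇒≢ (∑-mono-< (R-≤ s) y (subst₂ (λ a b → ⟦ a ⟧ < ⟦ b ⟧) (sym q) (sym p) ≤-refl)) eq)

  module _ {z : Fin n} (z∈K : K 2 z ≡ true) (z∈I : I 2 z ≡ true) where

    z-row : ∀ {s y} → 2 ≤ s → R s y ≡ true → B z y ≡ false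
    z-row {s} {y} 2≤s p = zeros s z y (I-mono* 2≤s z∈I) (proj₁ (R-elim s p))

    z-col : ∀ {s y} → 2 ≤ s → R (suc s) y ≡ true → B y z ≡ true
    z-col {s} {y} 2≤s p = ones s y z y∉I (K-mono* 2≤s z∈K) λ { refl → clash (I-mono* (≤-trans 2≤s (n≤1+n s)) z∈I) y∉I }
      where y∉I = proj₂ (R-elim (suc s) p)

    -- The vertex `z` is reached on both sides. As a reached row it has a zero towards an unreached
    -- column `y`, and as a reached column it has a one from a row `y` that is missed one level
    -- later, hence level 3. So `B` is asymmetric at `y`, which happens only inside `S`.
    R₃⊆S : ∀ y → R 3 y ≡ true → y ∈ₗ S
    R₃⊆S y p = asymmetric⇒∈ (z-row {3} (s≤s (s≤s z≤n)) p) (z-col {2} ≤-refl p)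

    -- No one-way pair enters the stalled set, but there are some from it to z,
    -- so its rows are too large.
    stalled⇒empty : ∀ s → 2 ≤ s → (∀ y → R s y ≡ true → R (suc s) y ≡ true) → ∀ y → R s y ≡ false
    stalled⇒empty s 2≤s stall y with dichotomy (R s y)
    ... | inj₂ p = p
    ... | inj₁ y∈R = ⊥-elim (<⇒≱ cols<rows rows≤cols)
      where
      open ≤-Reasoning
      -- Ones between two members of `R s`. Adding `h` on one side and its transpose on the other
      -- evens out these pairs, and only pairs with one end outside are compared.
      h : Fin n → Fin n → ℕ
      h y x = ⟦ R s y ⟧ * (⟦ R s x ⟧ * ⟦ B y x ⟧)
      pointwise : ∀ y x → ⟦ R s y ⟧ * ⟦ B x y ⟧ + h y x ≤ ⟦ R s y ⟧ * ⟦ B y x ⟧ + h x y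
      pointwise y x with R s y in y∈R | R s x in x∈R
      ... | false | _ = z≤n
      ... | true | true = ≤-reflexive (swap ⟦ B x y ⟧ ⟦ B y x ⟧)
        where
        swap : ∀ a b → 1 * a + 1 * (1 * b) ≡ 1 * b + 1 * (1 * a)
        swap = solve-∀
      ... | true | false = +-monoˡ-≤ 0 (+-monoˡ-≤ 0 (entry (dichotomy (I s x)) (dichotomy (K s x))))
        where
        entry : I s x ≡ true ⊎ I s x ≡ false → K s x ≡ true ⊎ K s x ≡ false → ⟦ B x y ⟧ ≤ ⟦ B y x ⟧
        entry (inj₁ p) _ rewrite zeros s x y p (proj₁ (R-elim s y∈R)) = z≤n
        -- The stall is needed here: a reached column `x` forces a one only in rows missed at level
        -- `suc s`.
        entry (inj₂ _) (inj₁ q) rewrite ones s y x (proj₂ (R-elim (suc s) (stall y y∈R))) q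
          (λ { refl → clash y∈R x∈R }) = ⟦⟧≤1 _
        entry (inj₂ p) (inj₂ q) = ⊥-elim (clash (R-intro s q p) x∈R)
      z∉R : R s z ≡ false
      z∉R with dichotomy (R s z)
      ... | inj₂ p = p
      ... | inj₁ p = ⊥-elim (clash (I-mono* 2≤s z∈I) (proj₂ (R-elim s p)))
      at-z : ⟦ R s y ⟧ * ⟦ B z y ⟧ + h y z < ⟦ R s y ⟧ * ⟦ B y z ⟧ + h z y
      at-z rewrite y∈R | z∉R | z-row 2≤s y∈R | z-col 2≤s (stall y y∈R) = s≤s z≤n
      cols<rows : ∑ (λ y → ⟦ R s y ⟧ * col B y) < ∑ (λ y → ⟦ R s y ⟧ * row B y)
      cols<rows = +-cancelʳ-< (∑ (λ y → ∑ (h y))) _ _ (begin-strict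
        ∑ (λ y → ⟦ R s y ⟧ * col B y) + ∑ (λ y → ∑ (h y))
          ≡⟨ cong (_+ ∑ (λ y → ∑ (h y))) (sym (∑-rows (⟦_⟧ ∘ R s) (λ y x → ⟦ B x y ⟧))) ⟩
        ∑ (λ y → ∑ λ x → ⟦ R s y ⟧ * ⟦ B x y ⟧) + ∑ (λ y → ∑ (h y))
          ≡⟨ sym (∑∑-distrib-+ (λ y x → ⟦ R s y ⟧ * ⟦ B x y ⟧) h) ⟩
        ∑ (λ y → ∑ λ x → ⟦ R s y ⟧ * ⟦ B x y ⟧ + h y x)
          <⟨ ∑∑-mono-< pointwise y z at-z ⟩
        ∑ (λ y → ∑ λ x → ⟦ R s y ⟧ * ⟦ B y x ⟧ + h x y)
          ≡⟨ ∑∑-distrib-+ (λ y x → ⟦ R s y ⟧ * ⟦ B y x ⟧) (flip h) ⟩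
        ∑ (λ y → ∑ λ x → ⟦ R s y ⟧ * ⟦ B y x ⟧) + ∑ (λ y → ∑ λ x → h x y)
          ≡⟨ cong₂ _+_ (∑-rows (⟦_⟧ ∘ R s) (λ y x → ⟦ B y x ⟧)) (sym (∑-comm h)) ⟩
        ∑ (λ y → ⟦ R s y ⟧ * row B y) + ∑ (λ y → ∑ (h y)) ∎)
      -- Rows with positive `ρ` lie in `I 0`, so on `R s` the row sum is just `D y`.
      rows≤cols : ∑ (λ y → ⟦ R s y ⟧ * row B y) ≤ ∑ (λ y → ⟦ R s y ⟧ * col B y)
      rows≤cols = ∑-mono λ y → row≤col y (dichotomy (R s y))
        where
        row≤col : ∀ y → R s y ≡ true ⊎ R s y ≡ false → ⟦ R s y ⟧ * row B y ≤ ⟦ R s y ⟧ * col B y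
        row≤col y (inj₂ p) rewrite p = z≤n
        row≤col y (inj₁ p) = *-monoʳ-≤ ⟦ R s y ⟧ (subst₂ _≤_ (sym (rows y)) (sym (cols y))
          (+-monoʳ-≤ (D y) (≤-trans (ρ≤0 (proj₂ (R-elim s p))) z≤n)))
          where
          ρ≤0 : I s y ≡ false → ρ y ≤ 0
          ρ≤0 y∉I = ≮⇒≥ λ 1≤ρ → clash (I-mono* z≤n (I₀-intro 1≤ρ)) y∉I

  root∈I : ∀ t {r} → 1 ≤ ρ r → I t r ≡ true
  root∈I t {r} 1≤ρ = I-mono* z≤n (I₀-intro 1≤ρ)

  module _ (m : ℕ) (∣S∣≤m : length S ≤ m) {r : Fin n} (1≤ρr : 1 ≤ ρ r) {c : Fin n} (1≤κc : 1 ≤ κ c) where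

    -- The origin of `5 + m`: from level 3 on, `R` has at most `m` elements, so it stalls at some
    -- level `3 + s` with `s ≤ m`, and the barrier for the transpose takes the levels `3 + s`,
    -- `4 + s` and `5 + s`.
    unreached⇒⊥ : (∀ k → K (5 + m) k ≡ true → κ k ≡ 0) → ⊥
    unreached⇒⊥ κ≡0 with any? (λ z → (K 2 z ≟ᵇ true) ×-dec (I 2 z ≟ᵇ true))
    ... | no none = Barrier.absurd 1≤c₂ D∈ allGraphic B loopless rows cols
      (I 0) (I 1) (I 2) (K 0) (K 1) (K 2) (λ i → I-mono 0) (λ i → I-mono 1) (λ i → K-mono 0) (λ i → K-mono 1)
      (zeros 0) (zeros 1) (zeros 2) (ones 0) (ones 1) (λ i p q → none (i , p , q))
      (root∈I 0 1≤ρr) 1≤ρr (λ k p → κ≡0 k (K-mono* (s≤s (s≤s z≤n)) p))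
    ... | yes (z , z∈K , z∈I)
      with s , s≤m , eq ← antitone-stalls m (λ s → ∣R∣ (3 + s)) (λ s → ∑-mono (R-≤ (3 + s)))
                            (≤-trans (∑-members S (R 3) (R₃⊆S z∈K z∈I)) ∣S∣≤m) =
      Barrier.absurd 1≤c₂ D∈ allGraphic (flip B) loopless cols rows
        (not ∘ K (5 + s)) (not ∘ K (4 + s)) (not ∘ K (3 + s)) (not ∘ I (5 + s)) (not ∘ I (4 + s)) (not ∘ I (3 + s))
        (λ k → contra (K-mono (4 + s))) (λ k → contra (K-mono (3 + s)))
        (λ i → contra (I-mono (4 + s))) (λ i → contra (I-mono (3 + s)))
        (λ i k p q → zeros (5 + s) k i (not-false q) (not-true p))
        (λ i k p q → zeros (4 + s) k i (not-false q) (not-true p))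
        (λ i k p q → zeros (3 + s) k i (not-false q) (not-true p))
        (λ i k p q ne → ones (4 + s) k i (not-true q) (not-false p) (ne ∘ sym))
        (λ i k p q ne → ones (3 + s) k i (not-true q) (not-false p) (ne ∘ sym))
        (λ i p q → clash (R-intro (3 + s) (not-true q) (not-true p))
           (stalled⇒empty z∈K z∈I (3 + s) (s≤s (s≤s z≤n)) (stalled (3 + s) eq) i))
        -- In the transpose the column `c` plays the part of the row with excess. It is unreached,
        -- because `κ` vanishes on all reached columns.
        (cong not (≢true λ p → <⇒≢ 1≤κc (sym (κ≡0 c (K-mono* (+-monoʳ-≤ 5 s≤m) p)))))
        1≤κc
        (λ i p → n≤0⇒n≡0 (≮⇒≥ λ 1≤ρ → clash (root∈I (3 + s) 1≤ρ) (not-true p)))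
      where
      contra : ∀ {a b : Bool} → (a ≡ true → b ≡ true) → not b ≡ true → not a ≡ true
      contra f p = cong not (¬mono f (not-true p))

    reached : ∃[ k ] 1 ≤ κ k × Augmented B k (2 + 3 * (5 + m))
    reached with any? (λ k → (K (5 + m) k ≟ᵇ true) ×-dec (1 ≤? κ k))
    ... | yes (k , k∈K , 1≤κ) = k , 1≤κ , augment (5 + m) B loopless (λ _ _ _ → refl) k∈K
    ... | no none = ⊥-elim (unreached⇒⊥ λ k p → n≤0⇒n≡0 (≮⇒≥ λ 1≤κ → none (k , p , 1≤κ)))

-- An augmentation over a support of size m uses a walk of at most 5 + m levels.
supportBound : ℕ → ℕ → ℕ
supportBound zero    m = m
supportBound (suc e) m = supportBound e (m + (2 + 3 * (5 + m)))

-- Correcting all row and column sums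

record Balanced (A : Mat n) (D : Fin n → ℕ) (size : ℕ) : Set where
  field
    matrix   : Mat n
    support  : List (Fin n)
    small    : length support ≤ size
    close    : Close support A matrix
    loopless : Loopless matrix
    rows     : ∀ i → row matrix i ≡ D i
    cols     : ∀ k → col matrix k ≡ D k

module _ {c₁ c₂ : ℕ} (1≤c₂ : 1 ≤ c₂) {D : Fin n → ℕ} (D∈ : Within c₁ c₂ D) (allGraphic : AllGraphic c₁ c₂ D)
         {A : Mat n} (A-sym : Symmetric A) where

  -- Each walk removes one unit of row excess and one of column excess, so the two totals stay equal
  -- and either both vanish or both provide an end of a further walk. The support collected so far
  -- is the `S` outside which the next walk may rely on the symmetry of `A`.
  balance : ∀ e m (S : List (Fin n)) → length S ≤ m → (B : Mat n) → Close S A B → Loopless B →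
            (ρ κ : Fin n → ℕ) → ∑ ρ ≡ e → ∑ κ ≡ e →
            (∀ i → row B i ≡ D i + ρ i) → (∀ k → col B k ≡ D k + κ k) → Balanced A D (supportBound e m)
  balance zero m S small B close loopless ρ κ ∑ρ ∑κ rows cols = record
    { matrix = B ; support = S ; small = small ; close = close ; loopless = loopless
    ; rows = λ i → trans (rows i) (vanish ∑ρ i) ; cols = λ k → trans (cols k) (vanish ∑κ k) }
    where
    vanish : ∀ {σ : Fin n → ℕ} → ∑ σ ≡ 0 → ∀ i → D i + σ i ≡ D i
    vanish {σ} eq i = trans (cong (D i +_) (n≤0⇒n≡0 (subst (σ i ≤_) eq (f≤∑ σ i)))) (+-identityʳ _)
  balance (suc e) m S small B close loopless ρ κ ∑ρ ∑κ rows cols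
    with r , 1≤ρr ← ∑-positive ρ (subst (1 ≤_) (sym ∑ρ) (s≤s z≤n))
       | c , 1≤κc ← ∑-positive κ (subst (1 ≤_) (sym ∑κ) (s≤s z≤n))
    with k , 1≤κk , aug ← Stage.reached 1≤c₂ D∈ allGraphic A-sym {S} close loopless rows cols m small 1≤ρr 1≤κc =
    balance e (m + (2 + 3 * (5 + m))) (S ++ Aug.support)
      (subst (_≤ m + (2 + 3 * (5 + m))) (sym (length-++ S)) (+-mono-≤ small Aug.small))
      Aug.result (Close-trans S Aug.support close Aug.close) Aug.loopless
      (λ i → ρ i ∸ δ Aug.root i) (λ j → κ j ∸ δ k j)
      (lower-total ρ Aug.root Aug.is-root ∑ρ) (lower-total κ k 1≤κk ∑κ)
      (lower-sums ρ Aug.root Aug.is-root (λ i → trans (Aug.rows i) (rows i)))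
      (lower-sums κ k 1≤κk (λ j → trans (Aug.cols j) (cols j)))
    where
    module Aug = Reach.Augmented aug
    open import Data.List.Properties using (length-++)
    δ≤ : ∀ (σ : Fin n → ℕ) x → 1 ≤ σ x → ∀ i → δ x i ≤ σ i
    δ≤ σ x 1≤σ i with δ-cases x i
    ... | inj₁ (refl , p) rewrite p = 1≤σ
    ... | inj₂ (_ , p)    rewrite p = z≤n
    lower-total : ∀ (σ : Fin n → ℕ) x → 1 ≤ σ x → ∑ σ ≡ suc e → ∑ (λ i → σ i ∸ δ x i) ≡ e
    lower-total σ x 1≤σ eq = +-cancelʳ-≡ 1 _ _ (begin
      ∑ (λ i → σ i ∸ δ x i) + 1             ≡⟨ cong (∑ (λ i → σ i ∸ δ x i) +_) (sym (∑-δ x)) ⟩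
      ∑ (λ i → σ i ∸ δ x i) + ∑ (δ x)       ≡⟨ sym (∑-distrib-+ (λ i → σ i ∸ δ x i) (δ x)) ⟩
      ∑ (λ i → σ i ∸ δ x i + δ x i)         ≡⟨ ∑-cong (λ i → m∸n+n≡m (δ≤ σ x 1≤σ i)) ⟩
      ∑ σ                                   ≡⟨ eq ⟩
      suc e                                 ≡⟨ +-comm 1 e ⟩
      e + 1                                 ∎)
      where open ≡-Reasoning
    lower-sums : ∀ (σ : Fin n → ℕ) x → 1 ≤ σ x → {f : Fin n → ℕ} → (∀ i → f i + δ x i ≡ D i + σ i) →
                 ∀ i → f i ≡ D i + (σ i ∸ δ x i)
    lower-sums σ x 1≤σ {f} eq i = +-cancelʳ-≡ (δ x i) _ _ (trans (eq i) (sym (trans (+-assoc (D i) _ _)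
      (cong (D i +_) (m∸n+n≡m (δ≤ σ x 1≤σ i))))))

-- Rounding an almost symmetric matrix

-- The handshake lemma, by removing vertex zero: its edges occur once in its row and once in its
-- column.
even-degree-sum : (F : Mat n) → Symmetric F → Loopless F → 2 ∣ ∑ (row F)
even-degree-sum {zero}  F F-sym F-loopless = 2 ∣0
even-degree-sum {suc n} F F-sym F-loopless = subst (2 ∣_) (sym total)
  (∣m∣n⇒∣m+n (m∣m*n (∑ λ k → ⟦ F zero (suc k) ⟧))
    (even-degree-sum (λ i k → F (suc i) (suc k)) (λ i k → F-sym (suc i) (suc k)) (F-loopless ∘ suc)))
  where
  open ≡-Reasoning
  x = ∑ λ k → ⟦ F zero (suc k) ⟧
  y = ∑ (row (λ i k → F (suc i) (suc k)))
  double : ∀ x y → 0 + x + (x + y) ≡ 2 * x + y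
  double = solve-∀
  total : ∑ (row F) ≡ 2 * x + y
  total = begin
    ⟦ F zero zero ⟧ + x + ∑ (λ i → ⟦ F (suc i) zero ⟧ + ∑ (λ k → ⟦ F (suc i) (suc k) ⟧))
      ≡⟨ cong₂ (λ a b → ⟦ a ⟧ + x + b) (F-loopless zero) (∑-distrib-+ (λ i → ⟦ F (suc i) zero ⟧) (row (λ i k → F (suc i) (suc k)))) ⟩
    0 + x + (∑ (λ i → ⟦ F (suc i) zero ⟧) + y)
      ≡⟨ cong (λ z → 0 + x + (z + y)) (∑-cong λ i → cong ⟦_⟧ (F-sym (suc i) zero)) ⟩
    0 + x + (x + y)
      ≡⟨ double x y ⟩
    2 * x + y ∎

-- Tallies and parities of lists

tally : {A : Set} → (A → ℕ) → List A → ℕ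
tally f []       = 0
tally f (x ∷ xs) = f x + tally f xs

tally-++ : {A : Set} (f : A → ℕ) (xs : List A) {ys : List A} → tally f (xs ++ ys) ≡ tally f xs + tally f ys
tally-++ f []       = refl
tally-++ f (x ∷ xs) = trans (cong (f x +_) (tally-++ f xs)) (sym (+-assoc (f x) _ _))

tally-↭ : {A : Set} (f : A → ℕ) {xs ys : List A} → xs ↭ ys → tally f xs ≡ tally f ys
tally-↭ f Perm.refl          = refl
tally-↭ f (Perm.prep x p)    = cong (f x +_) (tally-↭ f p)
tally-↭ f (Perm.swap x y p)  = trans (cong (λ z → f x + (f y + z)) (tally-↭ f p)) (exchange (f x) (f y) _)
  where
  exchange : ∀ a b c → a + (b + c) ≡ b + (a + c)
  exchange = solve-∀
tally-↭ f (Perm.trans p q)   = trans (tally-↭ f p) (tally-↭ f q)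

tally-positive : {A : Set} (f : A → ℕ) (xs : List A) → 1 ≤ tally f xs → ∃[ x ] x ∈ₗ xs × 1 ≤ f x
tally-positive f (x ∷ xs) p with f x in eq
... | suc _ = x , here refl , subst (1 ≤_) (sym eq) (s≤s z≤n)
... | zero with y , y∈xs , q ← tally-positive f xs p = y , there y∈xs , q

odd : {A : Set} → List A → Bool
odd []       = false
odd (x ∷ xs) = not (odd xs)

odd-++ : {A : Set} (xs : List A) {ys : List A} → odd (xs ++ ys) ≡ odd xs xor odd ys
odd-++ [] = refl
odd-++ (x ∷ xs) {ys} rewrite odd-++ xs {ys} with odd xs | odd ys
... | true  | true  = refl
... | true  | false = refl
... | false | _     = refl

even⇒¬odd : {A : Set} (xs : List A) → 2 ∣ length xs → odd xs ≡ false
even⇒¬odd []           _ = refl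
even⇒¬odd (x ∷ [])     p with () ← ∣1⇒≡1 p
even⇒¬odd (x ∷ y ∷ xs) p rewrite even⇒¬odd xs (∣m+n∣m⇒∣n p (m∣m*n {2} 1)) = refl

-- Positions are counted from 1.
odds evens : {A : Set} → List A → List A
odds []       = []
odds (x ∷ xs) = x ∷ evens xs
evens []       = []
evens (x ∷ xs) = odds xs

odds++evens : {A : Set} (xs : List A) → xs ↭ odds xs ++ evens xs
odds++evens []       = ↭-refl
odds++evens (x ∷ xs) = ↭-prep x (↭-trans (odds++evens xs) (++-comm (odds xs) (evens xs)))

evens++odds : {A : Set} (xs : List A) → xs ↭ evens xs ++ odds xs
evens++odds xs = ↭-trans (odds++evens xs) (++-comm (odds xs) (evens xs))

-- Closed trails in balanced digraphs

Arc : ℕ → Set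
Arc n = Fin n × Fin n

out inn deg : List (Arc n) → Fin n → ℕ
out L v = tally (λ (a , b) → δ a v) L
inn L v = tally (λ (a , b) → δ b v) L
deg L v = tally (λ (a , b) → δ a v + δ b v) L

data Chain {n} : Fin n → Fin n → List (Arc n) → Set where
  []   : ∀ {x} → Chain x x []
  cons : ∀ {x y z C} → Chain y z C → Chain x z ((x , y) ∷ C)

chain-++ : ∀ {x y z : Fin n} {C E} → Chain x y C → Chain y z E → Chain x z (C ++ E)
chain-++ []       d = d
chain-++ (cons c) d = cons (chain-++ c d)

chain-split : ∀ {x z q : Fin n} {C} → Chain x z C → q ∈ₗ map proj₁ C →
              ∃₂ λ A B → C ≡ A ++ B × Chain x q A × Chain q z B
chain-split (cons c) (here refl) = [] , _ , refl , [] , cons c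
chain-split (cons c) (there q∈) with A , B , refl , a , b ← chain-split c q∈ = _ ∷ A , B , refl , cons a , b

target-visited : ∀ {x z a b : Fin n} {C} → Chain x z C → (a , b) ∈ₗ C → b ∈ₗ map proj₁ C ⊎ b ≡ z
target-visited (cons [])         (here refl) = inj₂ refl
target-visited (cons (cons c))   (here refl) = inj₁ (there (here refl))
target-visited (cons c)          (there p) with target-visited c p
... | inj₁ q = inj₁ (there q)
... | inj₂ q = inj₂ q

not-injective : ∀ {a b} → not a ≡ not b → a ≡ b
not-injective {true}  {true}  _ = refl
not-injective {false} {false} _ = refl

-- Consecutive arcs (x , y) , (y , z) have together the outgoing degrees
-- of the endpoints of the first.
deg-odds : ∀ {x z : Fin n} {C} → Chain x z C → ∀ v → deg (odds C) v ≡ out C v + ⟦ odd C ⟧ * δ z v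
deg-odds [] v = refl
deg-odds {x = x} {z} (cons []) v = expand (δ x v) (δ z v)
  where
  expand : ∀ a b → a + b + 0 ≡ a + 0 + 1 * b
  expand = solve-∀
deg-odds {x = x} {z} (cons {y = y} (cons {C = C} c)) v with odd C | deg-odds c v
... | true  | ih = trans (cong (δ x v + δ y v +_) ih) (assoc (δ x v) (δ y v) (out C v) _)
  where
  assoc : ∀ a b c d → a + b + (c + d) ≡ a + (b + c) + d
  assoc = solve-∀
... | false | ih = trans (cong (δ x v + δ y v +_) ih) (assoc (δ x v) (δ y v) (out C v) _)
  where
  assoc : ∀ a b c d → a + b + (c + d) ≡ a + (b + c) + d
  assoc = solve-∀

-- Without its first arc the chain has even length and its even positions become odd ones, so
-- `deg-odds` applies. For an odd closed chain the two choices thus err at the base in opposite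
-- directions: the odd positions give one too many, the even ones one too few.
deg-evens : ∀ {x z : Fin n} {C} → Chain x z C → odd C ≡ true → ∀ v → deg (evens C) v + δ x v ≡ out C v
deg-evens {x = x} {z} (cons {C = C} c) odd-C v = begin
  deg (odds C) v + δ x v                    ≡⟨ cong (_+ δ x v) (deg-odds c v) ⟩
  out C v + ⟦ odd C ⟧ * δ z v + δ x v       ≡⟨ cong (λ b → out C v + ⟦ b ⟧ * δ z v + δ x v) (not-injective {odd C} {false} odd-C) ⟩
  out C v + 0 + δ x v                       ≡⟨ rearrange (out C v) (δ x v) ⟩
  δ x v + out C v                           ∎
  where
  open ≡-Reasoning
  rearrange : ∀ a b → a + 0 + b ≡ b + a
  rearrange = solve-∀

Circular : List (Arc n) → Set
Circular L = ∀ v → out L v ≡ inn L v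

bring-forward : {A : Set} {x : A} {xs : List A} → x ∈ₗ xs → ∃[ ys ] xs ↭ x ∷ ys
bring-forward x∈xs with ys , zs , refl ← ∈-∃++ x∈xs = ys ++ zs , shift _ ys zs

-- The hypothesis says that one more arc from `a` to `x` would balance `L`. Hence at any `x` other
-- than `a` an outgoing arc is left, and the walk can only end at `a`.
return : ∀ fuel (L : List (Arc n)) {a x} → length L ≤ fuel → (∀ v → out L v + δ a v ≡ inn L v + δ x v) →
         ∃₂ λ C L′ → Chain x a C × L ↭ C ++ L′ × Circular L′
return fuel L {a} {x} small balanced with δ-cases a x
... | inj₁ (refl , _) = [] , L , [] , ↭-refl , λ v → +-cancelʳ-≡ (δ a v) _ _ (balanced v)
... | inj₂ (a≢x , p) with tally-positive (λ (b , _) → δ b x) L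
      (subst (1 ≤_) (trans (sym (trans (balanced x) (cong (inn L x +_) (δ-same x)))) (trans (cong (out L x +_) p) (+-identityʳ _)))
        (m≤n+m 1 (inn L x)))
...   | (b , y) , by∈L , q with δ-cases b x
...     | inj₂ (_ , r) rewrite r with () ← q
...     | inj₁ (refl , _) with L₁ , L↭ ← bring-forward by∈L with fuel | subst (_≤ fuel) (↭-length L↭) small
...       | suc fuel′ | s≤s small′ = prepend (return fuel′ L₁ {a} {y} small′ balanced′)
  where
  prepend : (∃₂ λ C L′ → Chain y a C × L₁ ↭ C ++ L′ × Circular L′) →
            ∃₂ λ C L′ → Chain x a C × L ↭ C ++ L′ × Circular L′
  prepend (C , L′ , c , L₁↭ , circ) = (x , y) ∷ C , L′ , cons c , ↭-trans L↭ (↭-prep _ L₁↭) , circ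
  rotate : ∀ a b c → a + b + c ≡ b + c + a
  rotate = solve-∀
  balanced′ : ∀ v → out L₁ v + δ a v ≡ inn L₁ v + δ y v
  balanced′ v = +-cancelʳ-≡ (δ x v) _ _ (begin
    out L₁ v + δ a v + δ x v   ≡⟨ sym (rotate (δ x v) (out L₁ v) (δ a v)) ⟩
    δ x v + out L₁ v + δ a v   ≡⟨ cong (_+ δ a v) (sym (tally-↭ _ L↭)) ⟩
    out L v + δ a v            ≡⟨ balanced v ⟩
    inn L v + δ x v            ≡⟨ cong (_+ δ x v) (tally-↭ _ L↭) ⟩
    δ y v + inn L₁ v + δ x v   ≡⟨ cong (_+ δ x v) (+-comm (δ y v) (inn L₁ v)) ⟩
    inn L₁ v + δ y v + δ x v   ∎)
    where open ≡-Reasoning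

record Extracted (L : List (Arc n)) (a : Fin n) : Set where
  constructor extracted
  field
    {chain rest} : List (Arc n)
    closed   : Chain a a chain
    perm     : L ↭ chain ++ rest
    circular : Circular rest
    shorter  : length rest < length L

extract : ∀ {L : List (Arc n)} {a b} → Circular L → (a , b) ∈ₗ L → Extracted L a
extract {L = L} {a} {b} circ ab∈L with L₀ , L↭ ← bring-forward ab∈L
  = close (return (length L₀) L₀ {a} {b} ≤-refl balanced)
  where
  close : (∃₂ λ C L′ → Chain b a C × L₀ ↭ C ++ L′ × Circular L′) → Extracted L a
  close (C , L′ , c , L₀↭ , circ′) = extracted (cons c) (↭-trans L↭ (↭-prep _ L₀↭)) circ′
    (subst (length L′ <_) (sym (↭-length L↭)) (s≤s (subst (length L′ ≤_) (sym (trans (↭-length L₀↭) (length-++ C))) (m≤n+m _ (length C)))))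
  balanced : ∀ v → out L₀ v + δ a v ≡ inn L₀ v + δ b v
  balanced v = begin
    out L₀ v + δ a v   ≡⟨ +-comm (out L₀ v) (δ a v) ⟩
    δ a v + out L₀ v   ≡⟨ sym (tally-↭ _ L↭) ⟩
    out L v            ≡⟨ circ v ⟩
    inn L v            ≡⟨ tally-↭ _ L↭ ⟩
    δ b v + inn L₀ v   ≡⟨ +-comm (δ b v) (inn L₀ v) ⟩
    inn L₀ v + δ b v   ∎
    where open ≡-Reasoning

-- Rounding the closed trails

link : Fin n → Fin n → Bool → Mat n → Mat n
link a b v F = set a b v (set b a v F)

Apart : Arc n → Arc n → Set
Apart (a , b) (c , d) = ¬ (a ≡ c × b ≡ d) × ¬ (a ≡ d × b ≡ c)

Apart-sym : {x y : Arc n} → Apart x y → Apart y x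
Apart-sym (f , g) = (λ (p , q) → f (sym p , sym q)) , (λ (p , q) → g (sym q , sym p))

data Match {n} (a b : Fin n) : Fin n → Fin n → Set where
  same     : Match a b a b
  opposite : Match a b b a
  apart    : ∀ {c d} → Apart (a , b) (c , d) → Match a b c d

match : (a b c d : Fin n) → Match a b c d
match a b c d with a ≟ c | b ≟ d | a ≟ d | b ≟ c
... | yes refl | yes refl | _ | _ = same
... | yes _ | no f | yes refl | yes refl = opposite
... | no f | _ | yes refl | yes refl = opposite
... | no f | _ | no g | _ = apart ((λ (p , _) → f p) , (λ (p , _) → g p))
... | no f | _ | yes _ | no g = apart ((λ (p , _) → f p) , (λ (_ , p) → g p))
... | yes _ | no f | no g | _ = apart ((λ (_ , p) → f p) , (λ (p , _) → g p))
... | yes _ | no f | yes _ | no g = apart ((λ (_ , p) → f p) , (λ (_ , p) → g p))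

set-twice : ∀ (a b : Fin n) v F → link a b v F b a ≡ v
set-twice a b v F with δ-cases a b
... | inj₁ (refl , _) = set-same a a v (set a a v F)
... | inj₂ (ne , _)   = trans (set-diff a b v (set b a v F) b a λ (p , _) → ne (sym p)) (set-same b a v F)

module _ {a b : Fin n} (v : Bool) (F : Mat n) where

  link-same : link a b v F a b ≡ v
  link-same = set-same a b v (set b a v F)

  link-opposite : link a b v F b a ≡ v
  link-opposite = set-twice a b v F

  link-apart : ∀ {c d} → Apart (a , b) (c , d) → link a b v F c d ≡ F c d
  link-apart {c} {d} (f , g) = trans (set-diff a b v (set b a v F) c d λ (p , q) → f (sym p , sym q))
    (set-diff b a v F c d λ (p , q) → g (sym q , sym p))

  link-sym : Symmetric F → Symmetric (link a b v F)
  link-sym F-sym c d with match a b c d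
  ... | same     = trans link-same (sym link-opposite)
  ... | opposite = trans link-opposite (sym link-same)
  ... | apart (f , g) = trans (link-apart (f , g)) (trans (F-sym c d) (sym (link-apart (g , f))))

  link-loopless : a ≢ b → Loopless F → Loopless (link a b v F)
  link-loopless a≢b F-loopless c = trans
    (link-apart ((λ (p , q) → a≢b (trans p (sym q))) , (λ (p , q) → a≢b (trans p (sym q))))) (F-loopless c)

  link-close : ∀ {S} → a ∈ₗ S → b ∈ₗ S → Close S F (link a b v F)
  link-close a∈S b∈S c d with match a b c d
  ... | same     = inj₁ (a∈S , b∈S)
  ... | opposite = inj₁ (b∈S , a∈S)
  ... | apart f  = inj₂ (sym (link-apart f))

module _ {a b : Fin n} (a≢b : a ≢ b) (F : Mat n) (F-sym : Symmetric F) where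

  private
    step : ∀ v → set b a v F a b ≡ F a b
    step v = set-diff b a v F a b λ (p , _) → a≢b p

  row-link : F a b ≡ false → ∀ x → row (link a b true F) x ≡ row F x + (δ a x + δ b x)
  row-link Fab x = begin
    row (link a b true F) x            ≡⟨ sym (row-drop _ _ a b (set-diff a b true (set b a true F)) (link-same {a = a} {b} true F) (trans (step true) Fab) x) ⟩
    row (set b a true F) x + δ a x     ≡⟨ cong (_+ δ a x) (sym (row-drop _ _ b a (set-diff b a true F) (set-same b a true F) (trans (F-sym b a) Fab) x)) ⟩
    row F x + δ b x + δ a x            ≡⟨ rearrange (row F x) (δ b x) (δ a x) ⟩
    row F x + (δ a x + δ b x)          ∎
    where
    open ≡-Reasoning
    rearrange : ∀ r b a → r + b + a ≡ r + (a + b)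
    rearrange = solve-∀

  row-unlink : F a b ≡ true → ∀ x → row (link a b false F) x + (δ a x + δ b x) ≡ row F x
  row-unlink Fab x = begin
    row (link a b false F) x + (δ a x + δ b x)   ≡⟨ sym (+-assoc _ (δ a x) (δ b x)) ⟩
    row (link a b false F) x + δ a x + δ b x     ≡⟨ cong (_+ δ b x) (row-drop _ _ a b (λ c d ne → sym (set-diff a b false (set b a false F) c d ne)) (trans (step false) Fab) (link-same {a = a} {b} false F) x) ⟩
    row (set b a false F) x + δ b x              ≡⟨ row-drop _ _ b a (λ c d ne → sym (set-diff b a false F c d ne)) (trans (F-sym b a) Fab) (set-same b a false F) x ⟩
    row F x                                      ∎
    where open ≡-Reasoning

AllPairs-resp-↭ : {A : Set} {R : A → A → Set} → (∀ {x y} → R x y → R y x) →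
                  {xs ys : List A} → xs ↭ ys → AllPairs R xs → AllPairs R ys
AllPairs-resp-↭ s Perm.refl         ps                     = ps
AllPairs-resp-↭ s (Perm.prep x σ)   (p ∷ ps)               = All-resp-↭ σ p ∷ AllPairs-resp-↭ s σ ps
AllPairs-resp-↭ s (Perm.swap x y σ) ((p ∷ px) ∷ (py ∷ ps)) =
  (s p ∷ All-resp-↭ σ py) ∷ All-resp-↭ σ px ∷ AllPairs-resp-↭ s σ ps
AllPairs-resp-↭ s (Perm.trans σ τ)  ps                     = AllPairs-resp-↭ s τ (AllPairs-resp-↭ s σ ps)

AllPairs-drop : {A : Set} {R : A → A → Set} (xs : List A) {ys : List A} → AllPairs R (xs ++ ys) → AllPairs R ys
AllPairs-drop []       ps       = ps
AllPairs-drop (x ∷ xs) (_ ∷ ps) = AllPairs-drop xs ps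

source-visited : ∀ {p z : Fin n} {C} → Chain p z C → odd C ≡ true → p ∈ₗ map proj₁ C
source-visited (cons c) _ = here refl

module Rounding {n} (S : List (Fin n)) where

  -- An undecided pair is a non-edge of `F`, so that deciding against it means merely forgetting it,
  -- as in `State-drop`.
  Free : Mat n → Arc n → Set
  Free F (a , b) = a ≢ b × F a b ≡ false × a ∈ₗ S × b ∈ₗ S

  -- F holds the edges decided so far, L the pairs still to be decided.
  record State (F : Mat n) (L : List (Arc n)) : Set where
    constructor state
    field
      symmetric : Symmetric F
      loopless  : Loopless F
      free      : All (Free F) L
      distinct  : AllPairs Apart L

  State-resp-↭ : ∀ {F L M} → L ↭ M → State F L → State F M
  State-resp-↭ σ (state s l f d) = state s l (All-resp-↭ σ f) (AllPairs-resp-↭ Apart-sym σ d)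

  State-drop : ∀ {F} M {L} → State F (M ++ L) → State F L
  State-drop M (state s l f d) = state s l (++⁻ʳ M f) (AllPairs-drop M d)

  record Absorbed (F : Mat n) (L : List (Arc n)) (gain : Fin n → ℕ) : Set where
    constructor absorbed
    field
      {next} : Mat n
      st     : State next L
      rows   : ∀ v → row next v ≡ row F v + gain v
      close  : Close S F next

  Absorbed-drop : ∀ {F} M {L f g} → Absorbed F (M ++ L) f → (∀ v → f v ≡ g v) → Absorbed F L g
  Absorbed-drop M (absorbed st rows close) eq =
    absorbed (State-drop M st) (λ v → trans (rows v) (cong (_ +_) (eq v))) close

  absorb : ∀ {F} U {L} → State F (U ++ L) → Absorbed F L (deg U)
  absorb [] st = absorbed st (λ v → sym (+-identityʳ _)) (λ _ _ → inj₂ refl)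
  absorb {F} ((a , b) ∷ U) {L} (state s l ((a≢b , Fab , a∈S , b∈S) ∷ f) (d ∷ ds))
    = let absorbed st rows close = absorb U {L} (state (link-sym true F s) (link-loopless true F a≢b l) (still-free f d) ds) in
    absorbed st
      (λ v → trans (rows v) (trans (cong (_+ deg U v) (row-link a≢b F s Fab v)) (+-assoc (row F v) _ _)))
      (Close-trans′ (link-close true F a∈S b∈S) close)
    where
    still-free : ∀ {M} → All (Free F) M → All (Apart (a , b)) M → All (Free (link a b true F)) M
    still-free []                        []       = []
    still-free ((ne , Fcd , c , d) ∷ fs) (e ∷ es) = (ne , trans (link-apart true F e) Fcd , c , d) ∷ still-free fs es

  -- The gain `out C` is exactly what the one-way entries along `C` contributed to the row sums, so
  -- the prescribed degrees are kept.
  absorb-even : ∀ {F a C L} → Chain a a C → odd C ≡ false → State F (C ++ L) → Absorbed F L (out C)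
  absorb-even {C = C} {L} c even st = Absorbed-drop (evens C)
    (absorb (odds C) (State-resp-↭ (↭-trans (++⁺ʳ L (odds++evens C)) (↭-reflexive (++-assoc (odds C) _ _))) st))
    λ v → trans (deg-odds c v) (trans (cong (λ b → out C v + ⟦ b ⟧ * _) even) (+-identityʳ _))

  splice : ∀ {F p q C E L} → Chain p p C → Chain q q E → odd C ≡ true → odd E ≡ true → q ∈ₗ map proj₁ C →
           State F (C ++ E ++ L) → Absorbed F L (λ v → out C v + out E v)
  splice {E = E} {L} c e odd-C odd-E q∈C st with X , Y , refl , x , y ← chain-split c q∈C =
    Absorbed-drop [] (absorb-even (chain-++ x (chain-++ e y)) even (State-resp-↭ σ st)) gain
    where
    even : odd (X ++ E ++ Y) ≡ false
    even rewrite odd-++ X {E ++ Y} | odd-++ E {Y} | odd-E with odd X | odd Y | trans (sym (odd-++ X {Y})) odd-C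
    ... | true  | false | _ = refl
    ... | false | true  | _ = refl
    σ : (X ++ Y) ++ E ++ L ↭ (X ++ E ++ Y) ++ L
    σ = ↭-trans (↭-reflexive (++-assoc X Y (E ++ L))) (↭-trans (++⁺ˡ X (shifts Y E))
      (↭-reflexive (sym (trans (++-assoc X (E ++ Y) L) (cong (X ++_) (++-assoc E Y L))))))
    rearrange : ∀ x e y → x + (e + y) ≡ x + y + e
    rearrange = solve-∀
    gain : ∀ v → out (X ++ E ++ Y) v ≡ out (X ++ Y) v + out E v
    gain v = begin
      out (X ++ E ++ Y) v              ≡⟨ tally-++ _ X ⟩
      out X v + out (E ++ Y) v         ≡⟨ cong (out X v +_) (tally-++ _ E) ⟩
      out X v + (out E v + out Y v)    ≡⟨ rearrange (out X v) (out E v) (out Y v) ⟩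
      out X v + out Y v + out E v      ≡⟨ cong (_+ out E v) (sym (tally-++ _ X)) ⟩
      out (X ++ Y) v + out E v         ∎
      where open ≡-Reasoning

  interleave : ∀ {C E : List (Arc n)} U W U′ W′ {L} → C ↭ U ++ W → E ↭ U′ ++ W′ →
               C ++ E ++ L ↭ (U ++ U′) ++ (W ++ W′) ++ L
  interleave {C} {E} U W U′ W′ {L} C↭ E↭ = ↭-trans (++⁺ C↭ (++⁺ʳ L E↭))
    (↭-trans (↭-reflexive (trans (++-assoc U W _) (cong (λ z → U ++ W ++ z) (++-assoc U′ W′ L))))
    (↭-trans (++⁺ˡ U (shifts W U′))
    (↭-reflexive (sym (trans (++-assoc U U′ _) (cong (λ z → U ++ U′ ++ z) (++-assoc W W′ L)))))))

  -- Rounding an odd closed chain leaves an error of one at its base; toggling the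
  -- pair p q repairs two such errors at once.
  connect : ∀ {F p q C E L} → Chain p p C → Chain q q E → odd C ≡ true → odd E ≡ true →
            p ≢ q → p ∈ₗ S → q ∈ₗ S → All (Apart (p , q)) (C ++ E ++ L) →
            State F (C ++ E ++ L) → Absorbed F L (λ v → out C v + out E v)
  connect {F} {p} {q} {C} {E} {L} c e odd-C odd-E p≢q p∈S q∈S fresh st@(state s l f d) with dichotomy (F p q)
  -- The even positions fall one short at `p` and at `q`, and the new edge supplies both.
  ... | inj₂ Fpq = Absorbed-drop (odds C ++ odds E) (absorb ((p , q) ∷ evens C ++ evens E)
      (State-resp-↭ (↭-prep (p , q) (interleave (evens C) (odds C) (evens E) (odds E) (evens++odds C) (evens++odds E)))
        (state s l ((p≢q , Fpq , p∈S , q∈S) ∷ f) (fresh ∷ d)))) gain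
    where
    open ≡-Reasoning
    rearrange : ∀ a b c d → a + b + (c + d) ≡ c + a + (d + b)
    rearrange = solve-∀
    gain : ∀ v → δ p v + δ q v + deg (evens C ++ evens E) v ≡ out C v + out E v
    gain v = begin
      δ p v + δ q v + deg (evens C ++ evens E) v                 ≡⟨ cong (δ p v + δ q v +_) (tally-++ _ (evens C)) ⟩
      δ p v + δ q v + (deg (evens C) v + deg (evens E) v)        ≡⟨ rearrange (δ p v) (δ q v) (deg (evens C) v) (deg (evens E) v) ⟩
      deg (evens C) v + δ p v + (deg (evens E) v + δ q v)        ≡⟨ cong₂ _+_ (deg-evens c odd-C v) (deg-evens e odd-E v) ⟩
      out C v + out E v                                          ∎
  -- The odd positions overshoot by one at `p` and at `q`, and deleting the edge compensates both.
  ... | inj₁ Fpq = unlinked-gain (Absorbed-drop (evens C ++ evens E) (absorb (odds C ++ odds E)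
      (State-resp-↭ (interleave (odds C) (evens C) (odds E) (evens E) (odds++evens C) (odds++evens E))
        (state (link-sym false F s) (link-loopless false F p≢q l) (All.map unlinked f) d))) (λ v → refl))
    where
    open ≡-Reasoning
    unlinked : ∀ {x} → Free F x → Free (link p q false F) x
    unlinked {a , b} (ne , Fab , m) = ne , lower (match p q a b) , m
      where
      lower : Match p q a b → link p q false F a b ≡ false
      lower same      = link-same {a = p} {q} false F
      lower opposite  = link-opposite {a = p} {q} false F
      lower (apart r) = trans (link-apart false F r) Fab
    rearrange : ∀ r a b c d → r + (a + 1 * c + (b + 1 * d)) ≡ r + (c + d) + (a + b)
    rearrange = solve-∀
    unlinked-gain : Absorbed (link p q false F) L (deg (odds C ++ odds E)) →
                    Absorbed F L (λ v → out C v + out E v)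
    unlinked-gain (absorbed st′ rows close) =
      absorbed st′ (λ v → trans (rows v) (gain v)) (Close-trans′ (link-close false F p∈S q∈S) close)
      where
      gain : ∀ v → row (link p q false F) v + deg (odds C ++ odds E) v ≡ row F v + (out C v + out E v)
      gain v = begin
        row (link p q false F) v + deg (odds C ++ odds E) v
          ≡⟨ cong (row (link p q false F) v +_) (trans (tally-++ _ (odds C)) (cong₂ _+_ (deg-odds c v) (deg-odds e v))) ⟩
        row (link p q false F) v + (out C v + ⟦ odd C ⟧ * δ p v + (out E v + ⟦ odd E ⟧ * δ q v))
          ≡⟨ cong₂ (λ x y → row (link p q false F) v + (out C v + ⟦ x ⟧ * δ p v + (out E v + ⟦ y ⟧ * δ q v))) odd-C odd-E ⟩
        row (link p q false F) v + (out C v + 1 * δ p v + (out E v + 1 * δ q v))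
          ≡⟨ rearrange (row (link p q false F) v) (out C v) (out E v) (δ p v) (δ q v) ⟩
        row (link p q false F) v + (δ p v + δ q v) + (out C v + out E v)
          ≡⟨ cong (_+ (out C v + out E v)) (row-unlink p≢q F s Fpq v) ⟩
        row F v + (out C v + out E v) ∎

∑-out : (L : List (Arc n)) → ∑ (out L) ≡ length L
∑-out {n} []      = ∑-zero {n} λ _ → refl
∑-out ((a , b) ∷ L) = trans (∑-distrib-+ (δ a) (out L)) (cong₂ _+_ (∑-δ a) (∑-out L))

module RoundAll {n} (S : List (Fin n)) (D : Fin n → ℕ) (even-D : 2 ∣ ∑ D) where

  open Rounding S
  open DecMembership {A = Arc n} (≡-dec _≟_ _≟_) using (_∈?_)
  open DecMembership {A = Fin n} _≟_ using () renaming (_∈?_ to _visited?_)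

  record Rounded (F : Mat n) : Set where
    constructor rounded
    field
      {graph}   : Mat n
      symmetric : Symmetric graph
      loopless  : Loopless graph
      rows      : ∀ v → row graph v ≡ D v
      close     : Close S F graph

  after : ∀ {F L gain} (a : Absorbed F L gain) → Rounded (Absorbed.next a) → Rounded F
  after a (rounded s l r c) = rounded s l r (Close-trans′ (Absorbed.close a) c)

  apart-from-chain : ∀ {p q : Fin n} {C} → Chain p p C → p ≢ q → ¬ q ∈ₗ map proj₁ C → ∀ {x} → x ∈ₗ C → Apart (p , q) x
  apart-from-chain c p≢q q∉C {a , b} x∈C =
    (λ { (refl , refl) → case target-visited c x∈C of λ { (inj₁ v) → q∉C v ; (inj₂ eq) → p≢q (sym eq) } }) ,
    (λ { (refl , refl) → q∉C (∈-map⁺ proj₁ x∈C) })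

  Apart-swap : ∀ {p q : Fin n} {x} → Apart (q , p) x → Apart (p , q) x
  Apart-swap (f , g) = (λ (a , b) → g (b , a)) , (λ (a , b) → f (b , a))

  -- If neither base lies on the other chain, the pair `p q` occurs in neither of them. Being absent
  -- from `L` as well, it is already decided, and toggling it cannot collide with a later decision.
  merge : ∀ {F p q C E L} → Chain p p C → Chain q q E → odd C ≡ true → odd E ≡ true →
          ¬ (p , q) ∈ₗ L → ¬ (q , p) ∈ₗ L →
          State F (C ++ E ++ L) → Absorbed F L (λ v → out C v + out E v)
  merge {p = p} {q} {C} {E} {L} c e odd-C odd-E pq∉L qp∉L st with q visited? map proj₁ C | p visited? map proj₁ E
  ... | yes q∈C | _ = splice c e odd-C odd-E q∈C st
  ... | no _ | yes p∈E = Absorbed-drop [] (splice e c odd-E odd-C p∈E (State-resp-↭ (shifts C E) st)) λ v → +-comm (out E v) (out C v)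
  ... | no q∉C | no p∉E = connect c e odd-C odd-E p≢q (endpoint c odd-C (++⁻ˡ C free)) (endpoint e odd-E (++⁻ˡ E (++⁻ʳ C free)))
      (All-++⁺ (All.tabulate (apart-from-chain c p≢q q∉C))
        (All-++⁺ (All.tabulate λ {x} x∈E → Apart-swap {x = x} (apart-from-chain e (p≢q ∘ sym) p∉E x∈E)) (All.tabulate apart-from-L))) st
    where
    open State st
    p≢q : p ≢ q
    p≢q refl = q∉C (source-visited c odd-C)
    endpoint : ∀ {F x M} → Chain x x M → odd M ≡ true → All (Free F) M → x ∈ₗ S
    endpoint (cons _) _ ((_ , _ , x∈S , _) ∷ _) = x∈S
    apart-from-L : ∀ {x} → x ∈ₗ L → Apart (p , q) x
    apart-from-L x∈L = (λ { (refl , refl) → pq∉L x∈L }) , (λ { (refl , refl) → qp∉L x∈L })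

  regroup : ∀ r c l {f g} → f ≡ r + c → g ≡ r + (c + l) → f + l ≡ g
  regroup r c l p q = trans (cong (_+ l) p) (trans (+-assoc r c l) (sym q))

  out-↭ : ∀ {L} C {L′ : List (Arc n)} → L ↭ C ++ L′ → ∀ v → out L v ≡ out C v + out L′ v
  out-↭ C σ v = trans (tally-↭ _ σ) (tally-++ _ C)

  -- The number of odd closed chains waiting to be rounded is none, one or two.
  none : ∀ fuel L {F} → length L ≤ fuel → Circular L → State F L → (∀ v → row F v + out L v ≡ D v) → Rounded F
  one : ∀ fuel L {F p C} → length L ≤ fuel → Circular L → Chain p p C → odd C ≡ true → State F (C ++ L) →
        (∀ v → row F v + (out C v + out L v) ≡ D v) → Rounded F
  two : ∀ fuel L {F p q C E} → length L ≤ fuel → Circular L → Chain p p C → odd C ≡ true → Chain q q E → odd E ≡ true →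
        State F (C ++ E ++ L) → (∀ v → row F v + (out C v + (out E v + out L v)) ≡ D v) → Rounded F
  -- Here the pair p q is itself undecided, and lies on a further closed chain.
  two-linked : ∀ fuel L {F p q C E} → length L ≤ fuel → Circular L → Chain p p C → odd C ≡ true → Chain q q E → odd E ≡ true →
        (p , q) ∈ₗ L →
        State F (C ++ E ++ L) → (∀ v → row F v + (out C v + (out E v + out L v)) ≡ D v) → Rounded F

  none _ [] _ _ (state s l _ _) degrees = rounded s l (λ v → trans (sym (+-identityʳ _)) (degrees v)) (λ _ _ → inj₂ refl)
  none (suc fuel) (x ∷ L) {F} (s≤s small) circ st degrees
    with extracted {C} {L′} c σ circ′ shorter ← extract circ (here refl) with dichotomy (odd C)
  ... | inj₂ even = after a (none fuel L′ (≤-trans (≤-pred shorter) small) circ′ (Absorbed.st a)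
      λ v → trans (regroup (row F v) (out C v) (out L′ v) (Absorbed.rows a v) refl) (trans (cong (row F v +_) (sym (out-↭ C σ v))) (degrees v)))
    where a = absorb-even c even (State-resp-↭ σ st)
  ... | inj₁ odd-C = one fuel L′ (≤-trans (≤-pred shorter) small) circ′ c odd-C (State-resp-↭ σ st)
      λ v → trans (cong (row F v +_) (sym (out-↭ C σ v))) (degrees v)

  one _ [] {F} {C = C} _ _ c odd-C (state s l _ _) degrees =
    -- The sum of `D` is the degree sum of the graph `F` plus the length of `C`. The first two are
    -- even, so no odd chain can remain alone.
    ⊥-elim (clash odd-C (even⇒¬odd C (∣m+n∣m⇒∣n (subst (2 ∣_) total even-D) (even-degree-sum F s l))))
    where
    total : ∑ D ≡ ∑ (row F) + length C
    total = trans (∑-cong λ v → trans (sym (degrees v)) (cong (row F v +_) (+-identityʳ _)))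
      (trans (∑-distrib-+ (row F) (out C)) (cong (∑ (row F) +_) (∑-out C)))
  one (suc fuel) (x ∷ L) {F} {C = C} (s≤s small) circ c odd-C st degrees
    with extracted {E} {L′} e σ circ′ shorter ← extract circ (here refl) with dichotomy (odd E)
  ... | inj₂ even = after a (one fuel L′ (≤-trans (≤-pred shorter) small) circ′ c odd-C (Absorbed.st a)
      λ v → trans (regroup (row F v) (out E v) (out C v + out L′ v) (Absorbed.rows a v) refl)
              (trans (cong (row F v +_) (trans (exchange (out E v) (out C v) (out L′ v)) (cong (out C v +_) (sym (out-↭ E σ v))))) (degrees v)))
    where
    a = absorb-even e even (State-resp-↭ (↭-trans (++⁺ˡ C σ) (shifts C E)) st)
    exchange : ∀ a b c → a + (b + c) ≡ b + (a + c)
    exchange = solve-∀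
  ... | inj₁ odd-E = two fuel L′ (≤-trans (≤-pred shorter) small) circ′ c odd-C e odd-E (State-resp-↭ (++⁺ˡ C σ) st)
      λ v → trans (cong (λ z → row F v + (out C v + z)) (sym (out-↭ E σ v))) (degrees v)

  two fuel L {F} {p} {q} {C} {E} small circ c odd-C e odd-E st degrees with (p , q) ∈? L | (q , p) ∈? L
  ... | yes pq∈L | _ = two-linked fuel L small circ c odd-C e odd-E pq∈L st degrees
  ... | no _ | yes qp∈L = two-linked fuel L small circ e odd-E c odd-C qp∈L (State-resp-↭ (shifts C E) st)
      λ v → trans (cong (row F v +_) (exchange (out E v) (out C v) (out L v))) (degrees v)
    where
    exchange : ∀ a b c → a + (b + c) ≡ b + (a + c)
    exchange = solve-∀
  ... | no pq∉L | no qp∉L = after a (none fuel L small circ (Absorbed.st a)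
      λ v → trans (regroup (row F v) (out C v + out E v) (out L v) (Absorbed.rows a v) refl)
              (trans (cong (row F v +_) (+-assoc (out C v) _ _)) (degrees v)))
    where a = merge c e odd-C odd-E pq∉L qp∉L st

  two-linked zero [] small circ c odd-C e odd-E () st degrees
  two-linked (suc fuel) L {F} {p} {q} {C} {E} small circ c odd-C e odd-E pq∈L st degrees
    with extracted {G} {L′} g σ circ′ shorter ← extract circ pq∈L with dichotomy (odd G)
  -- Absorbing `G` decides the pair `p q`, and the same two odd chains are tried again with a
  -- shorter `L′`.
  ... | inj₂ even = after a (two fuel L′ (≤-pred (≤-trans shorter small)) circ′ c odd-C e odd-E (Absorbed.st a)
      λ v → trans (regroup (row F v) (out G v) (out C v + (out E v + out L′ v)) (Absorbed.rows a v) refl)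
              (trans (cong (row F v +_) (trans (exchange (out G v) (out C v) (out E v) (out L′ v)) (cong (λ z → out C v + (out E v + z)) (sym (out-↭ G σ v))))) (degrees v)))
    where
    a = absorb-even g even (State-resp-↭ (↭-trans (++⁺ˡ C (↭-trans (++⁺ˡ E σ) (shifts E G))) (shifts C G)) st)
    exchange : ∀ g c e l → g + (c + (e + l)) ≡ c + (e + (g + l))
    exchange = solve-∀
  -- `G` starts at `p` and so meets `C` there. These two are joined, and `E` alone keeps waiting.
  ... | inj₁ odd-G = after a (one fuel L′ (≤-pred (≤-trans shorter small)) circ′ e odd-E (Absorbed.st a)
      λ v → trans (regroup (row F v) (out C v + out G v) (out E v + out L′ v) (Absorbed.rows a v) refl)
              (trans (cong (row F v +_) (trans (exchange (out G v) (out C v) (out E v) (out L′ v)) (cong (λ z → out C v + (out E v + z)) (sym (out-↭ G σ v))))) (degrees v)))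
    where
    a = splice c g odd-C odd-G (source-visited c odd-C) (State-resp-↭ (++⁺ˡ C (↭-trans (++⁺ˡ E σ) (shifts E G))) st)
    exchange : ∀ g c e l → c + g + (e + l) ≡ c + (e + (g + l))
    exchange = solve-∀

  round : ∀ L {F} → Circular L → State F L → (∀ v → row F v + out L v ≡ D v) → Rounded F
  round L = none (length L) L ≤-refl

-- The digraph of one-way entries

tally-filter : {A : Set} {P : Pred A 0ℓ} (P? : Decidable P) (f : A → ℕ) (xs : List A) →
               tally f (filter P? xs) ≡ tally (λ x → ⟦ does (P? x) ⟧ * f x) xs
tally-filter P? f []       = refl
tally-filter P? f (x ∷ xs) with does (P? x)
... | true  = cong₂ _+_ (sym (+-identityʳ (f x))) (tally-filter P? f xs)
... | false = tally-filter P? f xs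

tally-tabulate : {A : Set} (f : A → ℕ) (g : Fin n → A) → tally f (tabulate g) ≡ ∑ (f ∘ g)
tally-tabulate {zero}  f g = refl
tally-tabulate {suc n} f g = cong (f (g zero) +_) (tally-tabulate f (g ∘ suc))

tally-map : {A B : Set} (f : B → ℕ) (g : A → B) (xs : List A) → tally f (map g xs) ≡ tally (f ∘ g) xs
tally-map f g []       = refl
tally-map f g (x ∷ xs) = cong (f (g x) +_) (tally-map f g xs)

tally-product : {A B : Set} (f : A × B → ℕ) (xs : List A) (ys : List B) →
                tally f (cartesianProduct xs ys) ≡ tally (λ x → tally (λ y → f (x , y)) ys) xs
tally-product f []       ys = refl
tally-product f (x ∷ xs) ys = trans (tally-++ f (map (x ,_) ys))
  (cong₂ _+_ (tally-map f (x ,_) ys) (tally-product f xs ys))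

∑-select : (f : Fin n → ℕ) (v : Fin n) → ∑ (λ a → f a * δ a v) ≡ f v
∑-select f v = begin
  ∑ (λ a → f a * δ a v)   ≡⟨ ∑-cong pointwise ⟩
  ∑ (λ a → f v * δ v a)   ≡⟨ sym (*-distribˡ-sum (f v) (δ v)) ⟩
  f v * ∑ (δ v)           ≡⟨ cong (f v *_) (∑-δ v) ⟩
  f v * 1                 ≡⟨ *-identityʳ (f v) ⟩
  f v                     ∎
  where
  open ≡-Reasoning
  pointwise : ∀ a → f a * δ a v ≡ f v * δ v a
  pointwise a with δ-cases a v
  ... | inj₁ (refl , _) = refl
  ... | inj₂ (ne , p) rewrite p | δ-diff (ne ∘ sym) = trans (*-zeroʳ (f a)) (sym (*-zeroʳ (f v)))

module OneWay {n} (B : Mat n) where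

  oneWay? : Decidable (λ ((a , b) : Arc n) → B a b ≡ true × B b a ≡ false)
  oneWay? (a , b) = (B a b ≟ᵇ true) ×-dec (B b a ≟ᵇ false)

  arcs : List (Arc n)
  arcs = filter oneWay? (cartesianProduct (allFin n) (allFin n))

  both : Mat n
  both a b = B a b ∧ B b a

  arcs-oneWay : ∀ {a b} → (a , b) ∈ₗ arcs → B a b ≡ true × B b a ≡ false
  arcs-oneWay p = proj₂ (∈-filter⁻ oneWay? {xs = cartesianProduct (allFin n) (allFin n)} p)

  indicator : ∀ a b → ⟦ does (oneWay? (a , b)) ⟧ ≡ ⟦ B a b ∧ not (B b a) ⟧
  indicator a b with B a b | B b a
  ... | true  | true  = refl
  ... | true  | false = refl
  ... | false | _     = refl

  tally-arcs : (f : Arc n → ℕ) → tally f arcs ≡ ∑ λ a → ∑ λ b → ⟦ B a b ∧ not (B b a) ⟧ * f (a , b)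
  tally-arcs f = begin
    tally f arcs
      ≡⟨ tally-filter oneWay? f (cartesianProduct (allFin n) (allFin n)) ⟩
    tally (λ x → ⟦ does (oneWay? x) ⟧ * f x) (cartesianProduct (allFin n) (allFin n))
      ≡⟨ tally-product (λ x → ⟦ does (oneWay? x) ⟧ * f x) (allFin n) (allFin n) ⟩
    tally (λ a → tally (λ b → ⟦ does (oneWay? (a , b)) ⟧ * f (a , b)) (allFin n)) (allFin n)
      ≡⟨ tally-tabulate (λ a → tally (λ b → ⟦ does (oneWay? (a , b)) ⟧ * f (a , b)) (allFin n)) (λ a → a) ⟩
    ∑ (λ a → tally (λ b → ⟦ does (oneWay? (a , b)) ⟧ * f (a , b)) (allFin n))
      ≡⟨ ∑-cong (λ a → trans (tally-tabulate (λ b → ⟦ does (oneWay? (a , b)) ⟧ * f (a , b)) (λ b → b))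
           (∑-cong λ b → cong (_* f (a , b)) (indicator a b))) ⟩
    ∑ (λ a → ∑ λ b → ⟦ B a b ∧ not (B b a) ⟧ * f (a , b)) ∎
    where open ≡-Reasoning

  out-arcs : ∀ v → out arcs v ≡ ∑ λ b → ⟦ B v b ∧ not (B b v) ⟧
  out-arcs v = trans (tally-arcs _) (trans
    (∑-cong λ a → sym (*-distribʳ-sum (δ a v) (λ b → ⟦ B a b ∧ not (B b a) ⟧)))
    (∑-select (λ a → ∑ λ b → ⟦ B a b ∧ not (B b a) ⟧) v))

  inn-arcs : ∀ v → inn arcs v ≡ ∑ λ a → ⟦ B a v ∧ not (B v a) ⟧
  inn-arcs v = trans (tally-arcs _) (∑-cong λ a → ∑-select (λ b → ⟦ B a b ∧ not (B b a) ⟧) v)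

  row-split : ∀ v → row both v + out arcs v ≡ row B v
  row-split v = trans (cong (row both v +_) (out-arcs v)) (trans
    (sym (∑-distrib-+ (λ b → ⟦ B v b ∧ B b v ⟧) (λ b → ⟦ B v b ∧ not (B b v) ⟧))) (∑-cong pointwise))
    where
    pointwise : ∀ b → ⟦ B v b ∧ B b v ⟧ + ⟦ B v b ∧ not (B b v) ⟧ ≡ ⟦ B v b ⟧
    pointwise b with B v b | B b v
    ... | true  | true  = refl
    ... | true  | false = refl
    ... | false | _     = refl

  col-split : ∀ v → row both v + inn arcs v ≡ col B v
  col-split v = trans (cong (row both v +_) (inn-arcs v)) (trans
    (sym (∑-distrib-+ (λ b → ⟦ B v b ∧ B b v ⟧) (λ b → ⟦ B b v ∧ not (B v b) ⟧))) (∑-cong pointwise))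
    where
    pointwise : ∀ b → ⟦ B v b ∧ B b v ⟧ + ⟦ B b v ∧ not (B v b) ⟧ ≡ ⟦ B b v ⟧
    pointwise b with B v b | B b v
    ... | true  | true  = refl
    ... | true  | false = refl
    ... | false | true  = refl
    ... | false | false = refl

  both-sym : Symmetric both
  both-sym a b with B a b | B b a
  ... | true  | true  = refl
  ... | true  | false = refl
  ... | false | true  = refl
  ... | false | false = refl

  arcs-distinct : AllPairs Apart arcs
  arcs-distinct = go arcs (λ p → p) (Unique.filter⁺ oneWay? (Unique.cartesianProduct⁺ (Unique.allFin⁺ n) (Unique.allFin⁺ n)))
    where
    go : ∀ L → (∀ {x} → x ∈ₗ L → x ∈ₗ arcs) → Unique L → AllPairs Apart L
    go []            sub []       = []
    go ((a , b) ∷ L) sub (f ∷ fs) = All.tabulate (λ {(c , d)} p →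
        (λ { (refl , refl) → All.lookup f p refl }) ,
        (λ { (refl , refl) → clash (proj₁ (arcs-oneWay (sub (here refl)))) (proj₂ (arcs-oneWay (sub (there p)))) })) ∷
      go L (sub ∘ there) fs

  module _ {A : Mat n} (A-sym : Symmetric A) {S : List (Fin n)} (close : Close S A B) where

    arcs-inside : ∀ {a b} → (a , b) ∈ₗ arcs → a ∈ₗ S × b ∈ₗ S
    arcs-inside {a} {b} p with arcs-oneWay p | close a b | close b a
    ... | _       | inj₁ (x , y) | _            = x , y
    ... | _       | inj₂ _       | inj₁ (y , x) = x , y
    ... | ab , ba | inj₂ q       | inj₂ r       = ⊥-elim (clash (trans (sym r) (trans (A-sym b a) (trans q ab))) ba)

    both-close : Close S A both
    both-close a b with close a b | close b a
    ... | inj₁ p | _            = inj₁ p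
    ... | inj₂ _ | inj₁ (y , x) = inj₁ (x , y)
    ... | inj₂ q | inj₂ r       = inj₂ (trans (sym (idem (A a b))) (cong₂ _∧_ q (trans (A-sym a b) r)))
      where
      idem : ∀ x → x ∧ x ≡ x
      idem true  = refl
      idem false = refl

    symmetrize : Loopless B → {D : Fin n → ℕ} → 2 ∣ ∑ D → (∀ i → row B i ≡ D i) → (∀ k → col B k ≡ D k) →
                 ∃[ Y ] Symmetric Y × Loopless Y × (∀ i → row Y i ≡ D i) × Close S A Y
    symmetrize loopless {D} even rows cols = graph , symmetric , loopless′ , rows′ , Close-trans′ both-close close′
      where
      open RoundAll S D even
      free : ∀ {x} → x ∈ₗ arcs → Rounding.Free S both x
      free {a , b} p with ab , ba ← arcs-oneWay p =
        (λ { refl → clash ab ba }) , trans (cong (B a b ∧_) ba) (∧-false (B a b)) , arcs-inside p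
        where
        ∧-false : ∀ x → x ∧ false ≡ false
        ∧-false true  = refl
        ∧-false false = refl
      result : Rounded both
      result = round arcs
        -- Row and column sums of `B` agree, and removing the symmetric part leaves equal out- and
        -- indegrees.
        (λ v → +-cancelˡ-≡ (row both v) _ _ (trans (row-split v) (trans (rows v) (trans (sym (cols v)) (sym (col-split v))))))
        (Rounding.state both-sym (λ v → cong (λ x → x ∧ x) (loopless v)) (All.tabulate free) arcs-distinct)
        (λ v → trans (row-split v) (rows v))
      open Rounded result renaming (loopless to loopless′; rows to rows′; close to close′)

abstract
  -- The excess is 2 and the initial support empty. The value is 85: the first walk touches at most
  -- 17 vertices, the second at most 2 + 3 (5 + 17) = 68 more. It is kept opaque so that exponents
  -- built from it stay symbolic.
  repairSize : ℕ
  repairSize = supportBound 2 0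

  supportBound≤repairSize : supportBound 2 0 ≤ repairSize
  supportBound≤repairSize = ≤-refl

module _ {c₁ c₂ : ℕ} (1≤c₂ : 1 ≤ c₂) {D : Fin n → ℕ} (D∈ : Within c₁ c₂ D) (even : 2 ∣ ∑ D)
         (allGraphic : AllGraphic c₁ c₂ D) where

  nearby : {A : Mat n} → Symmetric A → Loopless A → ∀ u v → (∀ i → row A i ≡ D i + (δ u i + δ v i)) →
           ∃₂ λ Y S → length S ≤ repairSize × Close S A Y × Symmetric Y × Loopless Y × (∀ i → row Y i ≡ D i)
  nearby {A} A-sym A-loopless u v rows-A =
    let Y , s , l , r , c = OneWay.symmetrize matrix A-sym close loopless even rows cols
    in Y , support , ≤-trans small supportBound≤repairSize , c , s , l , r
    where
    two : ∑ (λ i → δ u i + δ v i) ≡ 2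
    two = trans (∑-distrib-+ (δ u) (δ v)) (cong₂ _+_ (∑-δ u) (∑-δ v))
    cols-A : ∀ k → col A k ≡ D k + (δ u k + δ v k)
    cols-A k = trans (∑-cong λ i → cong ⟦_⟧ (A-sym i k)) (rows-A k)
    open Balanced (balance 1≤c₂ D∈ allGraphic A-sym 2 0 [] z≤n A Close-refl A-loopless _ _ two two rows-A cols-A)

-- Counting realizations

toMat : Adjacency n → Mat n
toMat G i = lookup (neighbours G i)

fromMat : Mat n → Adjacency n
fromMat B = Vec.tabulate λ i → Vec.tabulate (B i)

toMat-fromMat : (B : Mat n) → ∀ i k → toMat (fromMat B) i k ≡ B i k
toMat-fromMat B i k = trans (cong (λ S → lookup S k) (Vec.lookup∘tabulate _ i)) (Vec.lookup∘tabulate (B i) k)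

toMat-injective : {G H : Adjacency n} → (∀ i k → toMat G i k ≡ toMat H i k) → G ≡ H
toMat-injective eq = ext λ i → ext (eq i)
  where
  ext : ∀ {A : Set} {n} {xs ys : Vec A n} → (∀ i → lookup xs i ≡ lookup ys i) → xs ≡ ys
  ext {xs = xs} {ys} eq = trans (sym (Vec.tabulate∘lookup xs)) (trans (Vec.tabulate-cong eq) (Vec.tabulate∘lookup ys))

∣∣-∑ : (S : Subset n) → ∣ S ∣ ≡ ∑ (λ k → ⟦ lookup S k ⟧)
∣∣-∑ []          = refl
∣∣-∑ (true ∷ S)  = cong suc (∣∣-∑ S)
∣∣-∑ (false ∷ S) = ∣∣-∑ S

sum-∑ : (D : Vec ℕ n) → Vec.sum D ≡ ∑ (lookup D)
sum-∑ []      = refl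
sum-∑ (d ∷ D) = cong (d +_) (sum-∑ D)

Realizes⇒ : {D : Vec ℕ n} {G : Adjacency n} → Realizes D G →
            Symmetric (toMat G) × Loopless (toMat G) × (∀ i → row (toMat G) i ≡ lookup D i)
Realizes⇒ {D = D} {G} ((irreflexive , symmetric) , degrees) =
  s , (λ i → ≢true (irreflexive i ∘ Vec.lookup⇒[]= i _)) , λ i → trans (sym (∣∣-∑ (neighbours G i))) (degrees i)
  where
  half : ∀ i k → toMat G i k ≡ true → toMat G k i ≡ true
  half i k p = Vec.[]=⇒lookup (symmetric i k (Vec.lookup⇒[]= k _ p))
  s : Symmetric (toMat G)
  s i k with dichotomy (toMat G i k) | dichotomy (toMat G k i)
  ... | inj₁ p | _      = trans p (sym (half i k p))
  ... | inj₂ p | inj₂ q = trans p (sym q)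
  ... | inj₂ p | inj₁ q = ⊥-elim (clash (half k i q) p)

⇒Realizes : {D : Vec ℕ n} (H : Mat n) → Symmetric H → Loopless H → (∀ i → row H i ≡ lookup D i) →
            Realizes D (fromMat H)
⇒Realizes {D = D} H symmetric loopless rows =
  ((λ i i∈ → clash (Vec.[]=⇒lookup i∈) (trans (entry i i) (loopless i))) ,
   (λ i k k∈ → Vec.lookup⇒[]= i _ (trans (entry k i) (trans (symmetric k i) (trans (sym (entry i k)) (Vec.[]=⇒lookup k∈)))))) ,
  λ i → trans (∣∣-∑ (neighbours (fromMat H) i)) (trans (∑-cong λ k → cong ⟦_⟧ (entry i k)) (rows i))
  where entry = toMat-fromMat H

lookup-unit : (u i : Fin n) → lookup (unit u) i ≡ δ u i
lookup-unit {n} u i with δ-cases u i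
... | inj₁ (refl , p) = trans (Vec.lookup∘update u (Vec.replicate n 0) 1) (sym p)
... | inj₂ (ne , p)   = trans (Vec.lookup∘update′ (ne ∘ sym) (Vec.replicate n 0) 1) (trans (Vec.lookup-replicate i 0) (sym p))

Edit : ℕ → Set
Edit n = Fin n × Fin n × Bool

apply : Edit n → Adjacency n → Adjacency n
apply (i , k , b) G = fromMat (set i k b (toMat G))

patch : ∀ {m} → Vec (Edit n) m → Adjacency n → Adjacency n
patch []       G = G
patch (e ∷ es) G = apply e (patch es G)

allEdits : ∀ n → List (Edit n)
allEdits n = cartesianProduct (allFin n) (cartesianProduct (allFin n) (true ∷ false ∷ []))

∈-allEdits : (e : Edit n) → e ∈ₗ allEdits n
∈-allEdits (i , k , b) = ∈-cartesianProduct⁺ (∈-allFin i) (∈-cartesianProduct⁺ (∈-allFin k) (bool b))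
  where
  bool : ∀ b → b ∈ₗ true ∷ false ∷ []
  bool true  = here refl
  bool false = there (here refl)

-- Every edit writes the value that `A` has at its position, so neither the order nor repetitions of
-- positions matter.
patch-positions : ∀ {m} (A Y : Adjacency n) (ps : Vec (Fin n × Fin n) m) →
                  (∀ i k → (i , k) Vec.∈ ps ⊎ toMat A i k ≡ toMat Y i k) →
                  A ≡ patch (Vec.map (λ (i , k) → i , k , toMat A i k) ps) Y
patch-positions A Y ps covered = toMat-injective λ i k → sym (restored ps i k (covered i k))
  where
  restored : ∀ {m} (ps : Vec (Fin _ × Fin _) m) i k → (i , k) Vec.∈ ps ⊎ toMat A i k ≡ toMat Y i k →
             toMat (patch (Vec.map (λ (i , k) → i , k , toMat A i k) ps) Y) i k ≡ toMat A i k
  restored [] i k (inj₂ eq) = sym eq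
  restored ((a , c) ∷ ps) i k p = trans (toMat-fromMat _ i k) (step p (δ-cases a i) (δ-cases c k))
    where
    B = toMat (patch (Vec.map (λ (i , k) → i , k , toMat A i k) ps) Y)
    elsewhere : (i , k) Vec.∈ ((a , c) ∷ ps) ⊎ toMat A i k ≡ toMat Y i k → ¬ (i ≡ a × k ≡ c) →
                set a c (toMat A a c) B i k ≡ toMat A i k
    elsewhere (inj₁ (VecAny.here refl)) ne = ⊥-elim (ne (refl , refl))
    elsewhere (inj₁ (VecAny.there p))   ne = trans (set-diff a c _ B i k ne) (restored ps i k (inj₁ p))
    elsewhere (inj₂ eq)              ne = trans (set-diff a c _ B i k ne) (restored ps i k (inj₂ eq))
    step : (i , k) Vec.∈ ((a , c) ∷ ps) ⊎ toMat A i k ≡ toMat Y i k →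
           (a ≡ i × δ a i ≡ 1) ⊎ (a ≢ i × δ a i ≡ 0) → (c ≡ k × δ c k ≡ 1) ⊎ (c ≢ k × δ c k ≡ 0) →
           set a c (toMat A a c) B i k ≡ toMat A i k
    step p (inj₁ (refl , _)) (inj₁ (refl , _)) = set-same a c _ B
    step p (inj₂ (ne , _)) _                   = elsewhere p (λ (q , _) → ne (sym q))
    step p _ (inj₂ (ne , _))                   = elsewhere p (λ (_ , q) → ne (sym q))

-- A fixed length makes the possible edit sequences the finite list `allVecs`, whose length is a
-- plain power.
pad : {A : Set} → A → (xs : List A) → ∀ m → length xs ≤ m → ∃ λ (v : Vec A m) → ∀ {y} → y ∈ₗ xs → y Vec.∈ v
pad {A} x [] m _ = Vec.replicate m x , λ ()
pad x (y ∷ ys) (suc m) (s≤s p) with v , f ← pad x ys m p = y ∷ v , λ { (here eq) → VecAny.here eq ; (there q) → VecAny.there (f q) }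

unique⊆⇒length≤ : {A : Set} (xs {ys} : List A) → Unique xs → (∀ {x} → x ∈ₗ xs → x ∈ₗ ys) → length xs ≤ length ys
unique⊆⇒length≤ [] _ _ = z≤n
unique⊆⇒length≤ (x ∷ xs) {ys} (x≢ ∷ xs!) sub with zs , σ ← bring-forward (sub (here refl)) =
  subst (suc (length xs) ≤_) (sym (↭-length σ)) (s≤s (unique⊆⇒length≤ xs xs! λ {y} y∈xs → shrink y∈xs (∈-resp-↭ σ (sub (there y∈xs)))))
  where
  shrink : ∀ {y zs} → y ∈ₗ xs → y ∈ₗ x ∷ zs → y ∈ₗ zs
  shrink y∈xs (here refl) = ⊥-elim (All.lookup x≢ y∈xs refl)
  shrink y∈xs (there p)   = p

length-cartesianProductWith : {A B C : Set} (f : A → B → C) (xs : List A) (ys : List B) →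
                              length (cartesianProductWith f xs ys) ≡ length xs * length ys
length-cartesianProductWith f []       ys = refl
length-cartesianProductWith f (x ∷ xs) ys = trans (length-++ (map (f x) ys))
  (cong₂ _+_ (length-map (f x) ys) (length-cartesianProductWith f xs ys))

length-allVecs : {A : Set} (xs : List A) (m : ℕ) → length (allVecs xs m) ≡ length xs ^ m
length-allVecs xs zero    = refl
length-allVecs xs (suc m) = trans (length-cartesianProductWith Vec._∷_ xs (allVecs xs m)) (cong (length xs *_) (length-allVecs xs m))

length-allFin : ∀ n → length (allFin n) ≡ n
length-allFin n = length-tabulate (λ i → i)

length-allEdits : ∀ n → length (allEdits n) ≡ n * (n * 2)
length-allEdits n = trans (length-cartesianProductWith _,_ (allFin n) _) (cong₂ _*_ (length-allFin n)
  (trans (length-cartesianProductWith _,_ (allFin n) (true ∷ false ∷ [])) (cong (_* 2) (length-allFin n))))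

-- The repair need not be injective: it suffices that every realization of `E` is a patch of some
-- realization of `D`, so that `𝒢 E` is contained in the list of all patches. The vertex serves as
-- padding.
∣𝒢∣-bound : ∀ m {D E : Vec ℕ n} → Fin n →
            (∀ {A} → Realizes E A → ∃₂ λ Y S → length S ≤ m × Close S (toMat A) (toMat Y) × Realizes D Y) →
            ∣𝒢∣ E ≤ (n * (n * 2)) ^ (m * m) * ∣𝒢∣ D
∣𝒢∣-bound {n} m {D} {E} u repair = ≤-trans
  (unique⊆⇒length≤ (𝒢 E) (𝒢-unique E) λ A∈ → covered (∈-𝒢⁻ E A∈))
  (≤-reflexive (trans (length-cartesianProductWith patch (allVecs (allEdits n) (m * m)) (𝒢 D))
    (cong (_* ∣𝒢∣ D) (trans (length-allVecs (allEdits n) (m * m)) (cong (_^ (m * m)) (length-allEdits n))))))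
  where
  covered : ∀ {A} → Realizes E A → A ∈ₗ cartesianProductWith patch (allVecs (allEdits n) (m * m)) (𝒢 D)
  covered {A} r with Y , S , small , close , rY ← repair {A} r with v , inside ← pad u S m small =
    subst (_∈ₗ cartesianProductWith patch (allVecs (allEdits n) (m * m)) (𝒢 D)) (sym recovered)
      (∈-cartesianProductWith⁺ patch (∈-allVecs ∈-allEdits edits) (∈-𝒢⁺ D {Y} rY))
    where
    edits : Vec (Edit n) (m * m)
    edits = Vec.map (λ (i , k) → i , k , toMat A i k) (Vec.allPairs v v)
    recovered : A ≡ patch edits Y
    recovered = patch-positions A Y (Vec.allPairs v v) λ i k → cover (close i k)
      where
      cover : ∀ {i k} → (i ∈ₗ S × k ∈ₗ S) ⊎ toMat A i k ≡ toMat Y i k →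
              (i , k) Vec.∈ Vec.allPairs v v ⊎ toMat A i k ≡ toMat Y i k
      cover (inj₁ (p , q)) = inj₁ (Vec.∈-allPairs⁺ (inside p) (inside q))
      cover (inj₂ eq)      = inj₂ eq

-- From counts to a rational polynomial

ι : ℕ → ℚ
ι a = ℤ.+ a ℚ./ 1

toℚᵘ-/ : ∀ a b → ℚ.toℚᵘ (ℤ.+ a ℚ./ suc b) ℚᵘ.≃ ℚᵘ.mkℚᵘ (ℤ.+ a) b
toℚᵘ-/ a b = ℚ.toℚᵘ-fromℚᵘ (ℚᵘ.mkℚᵘ (ℤ.+ a) b)

/-≤-ι : ∀ a b c .{{_ : NonZero b}} → a ≤ c * b → ℤ.+ a ℚ./ b ℚ.≤ ι c
/-≤-ι a (suc b) c a≤cb = ℚ.toℚᵘ-cancel-≤ (ℚᵘ.≤-trans (ℚᵘ.≤-reflexive (toℚᵘ-/ a b))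
  (ℚᵘ.≤-trans (ℚᵘ.*≤* (subst₂ ℤ._≤_ (sym (ℤ.*-identityʳ (ℤ.+ a))) (ℤ.pos-* c (suc b)) (ℤ.+≤+ a≤cb)))
    (ℚᵘ.≤-reflexive (ℚᵘ.≃-sym (toℚᵘ-/ c 0)))))

ι-mono : ∀ {a c} → a ≤ c → ι a ℚ.≤ ι c
ι-mono {a} {c} a≤c = /-≤-ι a 1 c (≤-trans a≤c (≤-reflexive (sym (*-identityʳ c))))

ι-+ : ∀ a b → ι a ℚ.+ ι b ≡ ι (a + b)
ι-+ a b = ℚ.toℚᵘ-injective (ℚᵘ.≃-trans (ℚ.toℚᵘ-homo-+ (ι a) (ι b)) (ℚᵘ.≃-trans (ℚᵘ.+-cong (toℚᵘ-/ a 0) (toℚᵘ-/ b 0))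
  (ℚᵘ.≃-trans (ℚᵘ.*≡* (cong₂ ℤ._*_ (cong₂ ℤ._+_ (ℤ.*-identityʳ (ℤ.+ a)) (ℤ.*-identityʳ (ℤ.+ b))) refl)) (ℚᵘ.≃-sym (toℚᵘ-/ (a + b) 0)))))

ι-* : ∀ a b → ι a ℚ.* ι b ≡ ι (a * b)
ι-* a b = ℚ.toℚᵘ-injective (ℚᵘ.≃-trans (ℚ.toℚᵘ-homo-* (ι a) (ι b)) (ℚᵘ.≃-trans (ℚᵘ.*-cong (toℚᵘ-/ a 0) (toℚᵘ-/ b 0))
  (ℚᵘ.≃-trans (ℚᵘ.*≡* (cong (ℤ._* ℤ.+ 1) (sym (ℤ.pos-* a b)))) (ℚᵘ.≃-sym (toℚᵘ-/ (a * b) 0)))))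

sumℚ-bound : {A : Set} (f : A → ℚ) (c : ℕ) → (xs : List A) → (∀ x → f x ℚ.≤ ι c) → sumℚ (map f xs) ℚ.≤ ι (length xs * c)
sumℚ-bound f c []       f≤c = ℚ.≤-refl
sumℚ-bound f c (x ∷ xs) f≤c = ℚ.≤-trans (ℚ.+-mono-≤ (f≤c x) (sumℚ-bound f c xs f≤c)) (ℚ.≤-reflexive (ι-+ c (length xs * c)))

monomial : ℕ → ℕ → Polynomial
monomial c e = replicate e 0ℚ ++ (ι c ∷ [])

eval-monomial : ∀ c e n → eval (monomial c e) (ι n) ≡ ι (n ^ e * c)
eval-monomial c zero    n = trans (cong (ι c ℚ.+_) (ℚ.*-zeroʳ (ι n))) (trans (ℚ.+-identityʳ (ι c)) (cong ι (sym (*-identityˡ c))))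
eval-monomial c (suc e) n = trans (ℚ.+-identityˡ _) (trans (cong (ι n ℚ.*_) (eval-monomial c e n))
  (trans (ι-* n (n ^ e * c)) (cong ι (sym (*-assoc n (n ^ e) c)))))

length-pairs : ∀ n → length (pairs n) ≤ n * n
length-pairs n = ≤-trans (length-filter _ (cartesianProduct (allFin n) (allFin n)))
  (≤-reflexive (trans (length-cartesianProductWith _,_ (allFin n) (allFin n)) (cong₂ _*_ (length-allFin n) (length-allFin n))))

edits-power : ∀ n k → n * n * (n * (n * 2)) ^ k ≡ n ^ (2 + (k + k)) * 2 ^ k
edits-power n zero    = base n
  where
  base : ∀ n → n * n * 1 ≡ n * (n * 1) * 1
  base = solve-∀
edits-power n (suc k) = trans (rearrange n ((n * (n * 2)) ^ k)) (trans (cong (n * n * 2 *_) (edits-power n k))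
  (trans (rearrange′ n (n ^ (k + k)) (2 ^ k)) (cong (λ e → n ^ (2 + suc e) * 2 ^ suc k) (sym (+-suc k k)))))
  where
  rearrange : ∀ n x → n * n * (n * (n * 2) * x) ≡ n * n * 2 * (n * n * x)
  rearrange = solve-∀
  rearrange′ : ∀ n x y → n * n * 2 * (n * (n * x) * y) ≡ n * (n * (n * (n * x))) * (2 * y)
  rearrange′ = solve-∀

-- Fully graphic regions

FullyGraphicRegions : Pred Seq 0ℓ
FullyGraphicRegions D = ∃[ n ] ∃[ s ] ∃[ c₁ ] ∃[ c₂ ]
  (c₁ < n × c₂ ≤ c₁ × 1 ≤ c₂) × (1 ≤ s × 2 ∣ s) × FullyGraphic (𝔻 n s c₁ c₂) × D ∈ 𝔻 n s c₁ c₂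

region⇒degreeSequence : ∀ D → FullyGraphicRegions D → IsDegreeSequence D
region⇒degreeSequence D (_ , _ , _ , _ , _ , _ , _ , isDegreeSequence , _) = isDegreeSequence

region⇒allGraphic : ∀ {s c₁ c₂} {D : Vec ℕ n} → c₁ < n → 1 ≤ c₂ → 2 ∣ s → Vec.sum D ≡ s →
                    FullyGraphic (𝔻 n s c₁ c₂) → AllGraphic c₁ c₂ (lookup D)
region⇒allGraphic {n} {s} {c₁} {c₂} {D} c₁<n 1≤c₂ 2∣s sum≡s fg D′ (within lower upper) total
  = realization (fg {n , Vec.tabulate D′} ((degrees , subst (2 ∣_) (sym total′) 2∣s) , refl , bounds , total′))
  where
  realization : Graphic (n , Vec.tabulate D′) → ∃[ H ] Symmetric H × Loopless H × (∀ i → row H i ≡ D′ i)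
  realization (G , r) with symmetric , loopless , rows ← Realizes⇒ {D = Vec.tabulate D′} {G} r =
    toMat G , symmetric , loopless , λ i → trans (rows i) (Vec.lookup∘tabulate D′ i)
  degrees : ∀ i → 1 ≤ lookup (Vec.tabulate D′) i × lookup (Vec.tabulate D′) i ≤ n ∸ 1
  degrees i rewrite Vec.lookup∘tabulate D′ i = ≤-trans 1≤c₂ (lower i) , ≤-trans (upper i) (∸-monoˡ-≤ 1 c₁<n)
  bounds : ∀ i → lookup (Vec.tabulate D′) i ≤ c₁ × c₂ ≤ lookup (Vec.tabulate D′) i
  bounds i rewrite Vec.lookup∘tabulate D′ i = upper i , lower i
  total′ : Vec.sum (Vec.tabulate D′) ≡ s
  total′ = trans (sum-∑ (Vec.tabulate D′)) (trans (∑-cong (Vec.lookup∘tabulate D′)) (trans total (trans (sym (sum-∑ D)) sum≡s)))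

𝒢-growth : {D : Vec ℕ n} → FullyGraphicRegions (n , D) → ∀ i j →
           ∣𝒢∣ (D ⊕ (unit i ⊕ unit j)) ≤ (n * (n * 2)) ^ (repairSize * repairSize) * ∣𝒢∣ D
𝒢-growth {D = D} (_ , s , c₁ , c₂ , (c₁<n , _ , 1≤c₂) , (_ , 2∣s) , fg , (_ , even) , refl , bounds , sum≡s) i j =
  ∣𝒢∣-bound (repairSize) {D} {D ⊕ (unit i ⊕ unit j)} i λ {A} r → repair {A} (Realizes⇒ {D = D ⊕ (unit i ⊕ unit j)} {A} r)
  where
  raised : ∀ a → lookup (D ⊕ (unit i ⊕ unit j)) a ≡ lookup D a + (δ i a + δ j a)
  raised a = trans (Vec.lookup-zipWith _+_ a D (unit i ⊕ unit j)) (cong (lookup D a +_)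
    (trans (Vec.lookup-zipWith _+_ a (unit i) (unit j)) (cong₂ _+_ (lookup-unit i a) (lookup-unit j a))))
  allGraphic : AllGraphic c₁ c₂ (lookup D)
  allGraphic = region⇒allGraphic {D = D} c₁<n 1≤c₂ 2∣s sum≡s (λ {x} → fg {x})
  encode : ∀ {A} → (∃₂ λ Y S → length S ≤ repairSize × Close S A Y × Symmetric Y × Loopless Y × (∀ i → row Y i ≡ lookup D i)) →
           ∃₂ λ Y S → length S ≤ repairSize × Close S A (toMat Y) × Realizes D Y
  encode (Y , S , small , close , Y-sym , Y-loopless , Y-rows) =
    fromMat Y , S , small , Close-trans′ close (λ a c → inj₂ (sym (toMat-fromMat Y a c))) , ⇒Realizes {D = D} Y Y-sym Y-loopless Y-rows
  repair : ∀ {A} → Symmetric (toMat A) × Loopless (toMat A) × (∀ a → row (toMat A) a ≡ lookup (D ⊕ (unit i ⊕ unit j)) a) →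
           ∃₂ λ Y S → length S ≤ repairSize × Close S (toMat A) (toMat Y) × Realizes D Y
  repair {A} (symmetric , loopless , rows) = encode
    (nearby 1≤c₂ {lookup D} (within (proj₂ ∘ bounds) (proj₁ ∘ bounds)) (subst (2 ∣_) (sum-∑ D) even)
      allGraphic {toMat A} symmetric loopless i j (λ a → trans (rows a) (raised a)))

-- There are at most n² pairs `i j`, each with a ratio of at most (2n²)^k, which gives the monomial
-- 2^k n^(2 + 2k).
polynomial-bound : ∀ k {𝔼 : Pred Seq 0ℓ} →
  (∀ {n} {D : Vec ℕ n} → (n , D) ∈ 𝔼 → ∀ i j → ∣𝒢∣ (D ⊕ (unit i ⊕ unit j)) ≤ (n * (n * 2)) ^ k * ∣𝒢∣ D) →
  ∃[ p ] ∀ {n} {D : Vec ℕ n} → (n , D) ∈ 𝔼 → (g : Graphic (n , D)) → ∂⁺⁺ (n , D) g ℚ.≤ eval p (ι n)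
polynomial-bound k growth = monomial (2 ^ k) (2 + (k + k)) , λ {n} {D} D∈ g → ℚ.≤-trans
  (sumℚ-bound (ratio (n , D) g) ((n * (n * 2)) ^ k) (pairs n) λ (i , j) →
    /-≤-ι (∣𝒢∣ (D ⊕ (unit i ⊕ unit j))) (∣𝒢∣ D) ((n * (n * 2)) ^ k) {{graphic⇒nonZero (n , D) g}} (growth D∈ i j))
  (ℚ.≤-trans (ι-mono (≤-trans (*-monoˡ-≤ _ (length-pairs n)) (≤-reflexive (edits-power n k))))
    (ℚ.≤-reflexive (sym (eval-monomial (2 ^ k) (2 + (k + k)) n))))

-- Infinitely many members: complete graphs

complete : ∀ n → Mat n
complete n i k = not (does (i ≟ k))

complete-sym : Symmetric (complete n)
complete-sym i k with δ-cases i k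
... | inj₁ (refl , _) = refl
... | inj₂ (ne , _) = cong not (trans (dec-false (i ≟ k) ne) (sym (dec-false (k ≟ i) (ne ∘ sym))))

complete-loopless : Loopless (complete n)
complete-loopless i = cong not (dec-true (i ≟ i) refl)

row-complete : (i : Fin (suc n)) → row (complete (suc n)) i ≡ n
row-complete {n} i = +-cancelʳ-≡ 1 _ _ (begin
  row (complete (suc n)) i + 1           ≡⟨ cong (row (complete (suc n)) i +_) (sym (∑-δ i)) ⟩
  row (complete (suc n)) i + ∑ (δ i)     ≡⟨ sym (∑-distrib-+ (λ k → ⟦ complete (suc n) i k ⟧) (δ i)) ⟩
  ∑ (λ k → ⟦ complete (suc n) i k ⟧ + δ i k) ≡⟨ ∑-cong (λ k → one (does (i ≟ k))) ⟩
  ∑ {suc n} (λ _ → 1)                    ≡⟨ ∑-const (suc n) 1 ⟩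
  suc n * 1                              ≡⟨ trans (*-identityʳ (suc n)) (+-comm 1 n) ⟩
  n + 1                                  ∎)
  where
  open ≡-Reasoning
  one : ∀ b → ⟦ not b ⟧ + ⟦ b ⟧ ≡ 1
  one true  = refl
  one false = refl

-- With `c₁` and `c₂` equal, the region contains this one sequence only, which the complete graph
-- realizes. At least two vertices are needed for positive degrees.
constant : ℕ → Seq
constant k = suc (suc k) , Vec.replicate (suc (suc k)) (suc k)

constant∈ : ∀ k → FullyGraphicRegions (constant k)
constant∈ k = suc (suc k) , Vec.sum K , suc k , suc k , (≤-refl , ≤-refl , s≤s z≤n) , (m≤m+n 1 _ , even) , (λ {E} → graphic {E}) ,
  ((λ i → subst (1 ≤_) (sym (entry i)) (s≤s z≤n) , ≤-reflexive (entry i)) , even) , refl ,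
  (λ i → ≤-reflexive (entry i) , ≤-reflexive (sym (entry i))) , refl
  where
  K = Vec.replicate (suc (suc k)) (suc k)
  entry : ∀ i → lookup K i ≡ suc k
  entry i = Vec.lookup-replicate i (suc k)
  even : 2 ∣ Vec.sum K
  even = subst (2 ∣_) (trans (∑-cong λ i → trans (row-complete i) (sym (entry i))) (sym (sum-∑ K)))
    (even-degree-sum (complete (suc (suc k))) complete-sym complete-loopless)
  graphic : FullyGraphic (𝔻 (suc (suc k)) (Vec.sum K) (suc k) (suc k))
  graphic {_ , D} (_ , refl , bounds , _) = fromMat (complete _) , ⇒Realizes {D = D} (complete _) complete-sym complete-loopless
    λ i → trans (row-complete i) (≤-antisym (proj₂ (bounds i)) (proj₁ (bounds i)))

corollary1p4 : PStable (λ D →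
    ∃[ n ] ∃[ s ] ∃[ c₁ ] ∃[ c₂ ]
    (c₁ < n × c₂ ≤ c₁ × 1 ≤ c₂) ×
    (1 ≤ s × 2 ∣ s) ×
    FullyGraphic (𝔻 n s c₁ c₂) ×
    D ∈ 𝔻 n s c₁ c₂)
corollary1p4 = record
  { degreeSequences = λ {D} → region⇒degreeSequence D
  ; infinite = constant , (λ eq → suc-injective (suc-injective (cong proj₁ eq))) , constant∈
  ; bounded = polynomial-bound (repairSize * repairSize) (λ {n} {D} → 𝒢-growth {n} {D}) }
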